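{- Let $\mathcal{T}$ be an oscillating tableau of length $r$ and let $\mathrm{Sun}(\mathcal{T})=(Q,S)$. Then $\mathrm{Des}(\mathcal{T})=\mathrm{Des}(Q)$.
   Context: An oscillating tableau of length $r$ is a sequence of partitions $(\emptyset=\mu^0,\dots,\mu^r)$ with consecutive Ferrers diagrams (English notation) differing by exactly one box; step $k$ is an expansion (box $b_k$ added) or contraction (box $b_k$ deleted). $k\in\{1,\dots,r-1\}$ is a descent of $\mathcal{T}$ if step $k$ is an expansion and step $k+1$ a contraction; or both are expansions with $b_k$ in a row strictly above $b_{k+1}$; or both are contractions with $b_k$ in a row strictly below $b_{k+1}$; $\mathrm{Des}(\mathcal{T})$ is the set of descents. A partial Young tableau is a filling of a Ferrers shape with distinct positive integers increasing along rows and down columns; its descent set is $\{k: k,k+1 \text{ are entries and } k+1 \text{ is in a row strictly below } k\}$. Sundaram's map $\mathrm{Sun}$ is the composition of three steps. (1) $\mathrm{Sun}_1$: set $\iota_0=\emptyset$, $T_0=\emptyset$; for $k=1,\dots,r$: if step $k$ is an expansion, $\iota_k=\iota_{k-1}$ and $T_k$ is $T_{k-1}$ with $k$ placed in box $b_k$; if step $k$ is a contraction, apply Robinson–Schensted column deletion (the inverse of column insertion) to $T_{k-1}$ starting at the corner box $b_k$, producing an ejected letter $x$ and the tableau $T_k$, and let $\iota_k$ be $\iota_{k-1}$ with the transposition $(x,k)$ adjoined. Put $\iota=\iota_r$ (a fixed-point-free involution of a set $A\subseteq\{1,\dots,r\}$) and $T=T_r$ (a partial Young tableau of shape $\mu^r$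 with entry set $\{1,\dots,r\}\setminus A$). (2) Let $I$ be the Robinson–Schensted (row) insertion tableau of the word $\iota(a_1)\iota(a_2)\cdots\iota(a_m)$, where $A=\{a_1<\dots<a_m\}$. (3) $\mathrm{Sun}_2$: the reading word of $I$ concatenates its rows from bottom to top, each row left to right; the reverse reading word $w^{rev}(I)$ is this word read backwards. $Q$ is obtained by column-inserting the letters of $w^{rev}(I)$, in order, into $T$; $S$ is the skew tableau of shape $\mathrm{sh}(Q)/\mathrm{sh}(T)$ obtained by writing, in each box created when a letter of $w^{rev}(I)$ is inserted, the index of the row of $I$ containing that letter. Then $\mathrm{Sun}(\mathcal{T})=(Q,S)$, where $Q$ is a standard Young tableau with $r$ boxes, with its usual descent set $\mathrm{Des}(Q)$. -}

module Defs where

open import Data.Nat using (ℕ; zero; suc; _+_; _∸_; _<_; _≤_; _≥_; _<ᵇ_; _≡ᵇ_)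
open import Data.Bool using (Bool; true; false; if_then_else_)
open import Data.List using (List; []; _∷_; [_]; _++_; length; reverse; concat; map; foldl; take; drop)
open import Data.Nat.ListAction using (sum)
open import Data.List.Relation.Unary.All using (All)
open import Data.List.Relation.Unary.Linked using (Linked)
open import Data.Maybe using (Maybe; just; nothing)
open import Data.Product using (_×_; _,_; proj₁; proj₂; Σ; ∃)
open import Data.Sum using (_⊎_)
open import Relation.Binary.PropositionalEquality using (_≡_)

-- Partitions and oscillating tableaux
--
-- A partition is the list of its (positive) row lengths, top to bottom,
-- weakly decreasing.  Rows are indexed from 0 (top row = row 0).

Partition : Set
Partition = List ℕ

IsPartition : Partition → Set
IsPartition μ = Linked _≥_ μ × All (λ x → 0 < x) μ

-- add a box at the end of row i (row i = length μ creates a new row;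
-- larger i produce non-partitions, excluded by IsPartition)
addBox : ℕ → Partition → Partition
addBox zero    []       = [ 1 ]
addBox zero    (x ∷ xs) = suc x ∷ xs
addBox (suc i) []       = 0 ∷ addBox i []
addBox (suc i) (x ∷ xs) = x ∷ addBox i xs

DiffOneBox : Partition → Partition → Set
DiffOneBox μ ν = ∃ (λ i → ν ≡ addBox i μ) ⊎ ∃ (λ i → μ ≡ addBox i ν)

-- an oscillating tableau (μ⁰ = ∅, μ¹, …, μʳ), given as the list of its
-- partitions; its length r is (length − 1)
IsOscTableau : List Partition → Set
IsOscTableau ps =
  Σ (List Partition) (λ rest → ps ≡ [] ∷ rest)
  × All IsPartition ps
  × Linked DiffOneBox ps

diffRow : List ℕ → List ℕ → ℕ
diffRow []       _        = 0
diffRow (x ∷ xs) []       = 0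
diffRow (x ∷ xs) (y ∷ ys) = if x ≡ᵇ y then suc (diffRow xs ys) else 0

data Step : Set where
  expansion   : ℕ → Step   -- box added in the given row
  contraction : ℕ → Step   -- box deleted in the given row

stepOf : Partition → Partition → Step
stepOf μ ν = if sum μ <ᵇ sum ν then expansion (diffRow μ ν) else contraction (diffRow ν μ)

-- steps 1..r of an oscillating tableau (list index k-1 = step k)
steps : List Partition → List Step
steps []            = []
steps (μ ∷ [])      = []
steps (μ ∷ ν ∷ ps)  = stepOf μ ν ∷ steps (ν ∷ ps)

nth : {A : Set} → ℕ → List A → Maybe A
nth _       []       = nothing
nth zero    (x ∷ xs) = just x
nth (suc n) (x ∷ xs) = nth n xs

data DescentPair : Step → Step → Set where
  exp-con : ∀ {i j} → DescentPair (expansion i) (contraction j)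
  exp-exp : ∀ {i j} → i < j → DescentPair (expansion i) (expansion j)
  con-con : ∀ {i j} → j < i → DescentPair (contraction i) (contraction j)

IsOscDescent : List Partition → ℕ → Set
IsOscDescent ps k =
  1 ≤ k × Σ Step (λ s → Σ Step (λ t →
    nth (k ∸ 1) (steps ps) ≡ just s × nth k (steps ps) ≡ just t × DescentPair s t))

-- Tableaux: list of rows, top to bottom, each row left to right.

Tableau : Set
Tableau = List (List ℕ)

shape : Tableau → List ℕ
shape = map length

rowOf : ℕ → Tableau → Maybe ℕ
rowOf x []       = nothing
rowOf x (r ∷ rs) = if memb r then just 0 else Data.Maybe.map suc (rowOf x rs)
  where
  memb : List ℕ → Bool
  memb []       = false
  memb (y ∷ ys) = if x ≡ᵇ y then true else memb ys

IsTabDescent : Tableau → ℕ → Set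
IsTabDescent Q k =
  Σ ℕ (λ i → Σ ℕ (λ j → rowOf k Q ≡ just i × rowOf (suc k) Q ≡ just j × i < j))

-- transpose (for tableaux of partition shape)
zipLong : List ℕ → Tableau → Tableau
zipLong []       cs       = cs
zipLong (x ∷ xs) []       = [ x ] ∷ zipLong xs []
zipLong (x ∷ xs) (c ∷ cs) = (x ∷ c) ∷ zipLong xs cs

transpose : Tableau → Tableau
transpose []       = []
transpose (r ∷ rs) = zipLong r (transpose rs)

bumpRow : ℕ → List ℕ → List ℕ × Maybe ℕ
bumpRow x []       = [ x ] , nothing
bumpRow x (y ∷ ys) with x <ᵇ y
... | true  = (x ∷ ys) , just y
... | false with bumpRow x ys
...   | (ys' , m) = (y ∷ ys') , m

rowInsert : ℕ → Tableau → Tableau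
rowInsert x []       = [ [ x ] ]
rowInsert x (r ∷ rs) with bumpRow x r
... | (r' , nothing) = r' ∷ rs
... | (r' , just y)  = r' ∷ rowInsert y rs

colInsert : ℕ → Tableau → Tableau
colInsert x T = transpose (rowInsert x (transpose T))

unbump' : ℕ → ℕ → List ℕ → List ℕ × ℕ
unbump' y z []       = [ y ] , z
unbump' y z (w ∷ ws) with w <ᵇ y
... | false = (y ∷ w ∷ ws) , z
... | true with unbump' y w ws
...   | (r' , o) = (z ∷ r') , o

unbump : ℕ → List ℕ → List ℕ × ℕ
unbump y []       = [] , y
unbump y (z ∷ zs) = unbump' y z zs

-- rows given bottom-to-top
unbumpRows : ℕ → Tableau → Tableau × ℕ
unbumpRows y []       = [] , y
unbumpRows y (r ∷ rs) with unbump y r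
... | (r' , o) with unbumpRows o rs
...   | (rs' , e) = (r' ∷ rs') , e

lastOr : ℕ → List ℕ → ℕ
lastOr d []       = d
lastOr d (x ∷ xs) = lastOr x xs

init : List ℕ → List ℕ
init []           = []
init (x ∷ [])     = []
init (x ∷ y ∷ ys) = x ∷ init (y ∷ ys)

nonEmptyRow : List ℕ → Tableau
nonEmptyRow []       = []
nonEmptyRow (x ∷ xs) = [ x ∷ xs ]

rowDelete : ℕ → Tableau → Tableau × ℕ
rowDelete idx T with nth idx T
... | nothing  = T , 0
... | just row with unbumpRows (lastOr 0 row) (reverse (take idx T))
...   | (before' , x) =
  (reverse before' ++ nonEmptyRow (init row) ++ drop (suc idx) T) , x

colDelete : ℕ → Tableau → Tableau × ℕ
colDelete i T with nth i T
... | nothing  = T , 0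
... | just row with rowDelete (length row ∸ 1) (transpose T)
...   | (T' , x) = transpose T' , x

addEntry : ℕ → ℕ → Tableau → Tableau
addEntry zero    k []       = [ [ k ] ]
addEntry zero    k (r ∷ rs) = (r ++ [ k ]) ∷ rs
addEntry (suc i) k []       = [] ∷ addEntry i k []
addEntry (suc i) k (r ∷ rs) = r ∷ addEntry i k rs

-- Sun₁ : processes steps k, k+1, … ; involution stored as list of pairs
sun₁ : ℕ → List Step → List (ℕ × ℕ) → Tableau → List (ℕ × ℕ) × Tableau
sun₁ k []                      ι T = ι , T
sun₁ k (expansion i   ∷ ss)   ι T = sun₁ (suc k) ss ι (addEntry i k T)
sun₁ k (contraction i ∷ ss)   ι T with colDelete i T
... | (T' , x) = sun₁ (suc k) ss ((x , k) ∷ ι) T'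

invApply : ℕ → List (ℕ × ℕ) → Maybe ℕ
invApply a []              = nothing
invApply a ((x , y) ∷ ps)  =
  if a ≡ᵇ x then just y else (if a ≡ᵇ y then just x else invApply a ps)

-- the word ι(a₁)ι(a₂)…ι(a_m) for A = {a₁ < … < a_m} ⊆ {1,…,r}
invWordFrom : ℕ → ℕ → List (ℕ × ℕ) → List ℕ
invWordFrom a zero    ι = []
invWordFrom a (suc n) ι with invApply a ι
... | nothing = invWordFrom (suc a) n ι
... | just b  = b ∷ invWordFrom (suc a) n ι

insertionTableau : List ℕ → Tableau
insertionTableau w = foldl (λ T x → rowInsert x T) [] w

labelRows : ℕ → Tableau → List (List (ℕ × ℕ))
labelRows i []       = []
labelRows i (r ∷ rs) = map (λ x → x , i) r ∷ labelRows (suc i) rs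

revReadingLabelled : Tableau → List (ℕ × ℕ)
revReadingLabelled I = reverse (concat (reverse (labelRows 1 I)))

-- skew tableau: list of ((row, column), entry), 0-based box coordinates
SkewTableau : Set
SkewTableau = List ((ℕ × ℕ) × ℕ)

newBox : List ℕ → List ℕ → ℕ × ℕ
newBox sh sh' with diffRow sh' sh
... | i with nth i sh
...   | nothing = i , 0
...   | just c  = i , c

sun₂ : List (ℕ × ℕ) → Tableau → SkewTableau → Tableau × SkewTableau
sun₂ []              Q S = Q , S
sun₂ ((x , l) ∷ ws)  Q S =
  sun₂ ws (colInsert x Q) ((newBox (shape Q) (shape (colInsert x Q)) , l) ∷ S)

Sun : List Partition → Tableau × SkewTableau
Sun ps with sun₁ 1 (steps ps) [] []
... | (ι , T) = sun₂ (revReadingLabelled (insertionTableau (invWordFrom 1 (length (steps ps)) ι))) T []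

{-# OPTIONS --safe #-}

-- A tableau has the descent k exactly when k + 1 precedes k in its column reading word, and the
-- order of k and k + 1 in a word is unchanged when adjacent letters that differ by at least 2 are
-- swapped.  Up to such swaps (_~_), row insertion appends a letter to the row reading word, so
-- column insertion prepends one to the column reading word, and column deletion splits one off.
-- Hence the column reading word of Q is equivalent to W = ι(a₁)…ι(a_m) followed by the column
-- reading word of T.
--
-- Let Wₙ be this word after n steps of Sun₁.  An expansion inserts n + 1 into the column reading
-- word; a contraction ejecting x inserts n + 1 at the place of x in the word of ι and moves x from
-- the front of the column reading word to the end of the word of ι.  So Wₙ₊₁ is equivalent to Wₙ
-- with the letter n + 1 inserted, and the order of n and n + 1, fixed once step n + 1 is done, is
-- read off the two steps.  For two contractions ejecting y₁ and then y₂ it is the order of y₁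
-- and y₂, which the bumping routes compare with the rows of the deleted boxes.
module Submission where

open import Defs
open import Data.List using (List)
open import Data.Nat using (ℕ)
open import Data.Product using (proj₁)
open import Function.Bundles using (_⇔_)
open import Data.Bool using (true; false; T)
open import Data.Empty using (⊥; ⊥-elim)
open import Data.List using ([]; _∷_; [_]; _++_; reverse; length; take; drop; map; concat; foldl; replicate; applyDownFrom; initLast; _∷ʳ′_)
open import Data.List.Membership.Propositional using (_∈_; _∉_)
open import Data.List.Membership.Propositional.Properties using (∈-++⁺ˡ; ∈-++⁺ʳ; ∈-++⁻)
open import Data.List.Properties
open import Data.List.Relation.Binary.Permutation.Propositional using (_↭_; ↭-refl; ↭-prep; ↭-swap; ↭-reflexive; ↭-sym; ↭-trans; ↭⇒↭ₛ)
open import Data.List.Relation.Binary.Permutation.Propositional.Properties using (∈-resp-↭; shift; ↭-reverse)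
import Data.List.Relation.Binary.Permutation.Setoid.Properties as PermS
open import Data.List.Relation.Unary.All as All using (All; []; _∷_)
import Data.List.Relation.Unary.All.Properties as All
open import Data.List.Relation.Unary.AllPairs using (AllPairs; []; _∷_)
open import Data.List.Relation.Unary.Any using (here; there)
open import Data.List.Relation.Unary.Linked using (Linked; []; [-]; _∷_)
open import Data.List.Relation.Unary.Unique.Propositional using (Unique)
import Data.List.Relation.Unary.Unique.Propositional.Properties as Unique
open import Data.Maybe using (just; nothing)
open import Data.Nat using (zero; suc; _+_; _<_; _≤_; _<ᵇ_; _≡ᵇ_; s≤s; z≤n)
open import Data.Nat.ListAction using (sum)
open import Data.Nat.Properties
open import Data.Product using (_×_; _,_; proj₂; ∃)
open import Data.Sum using (_⊎_; inj₁; inj₂)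
open import Data.Unit using (⊤; tt)
open import Function.Bundles using (mk⇔)
open import Relation.Binary.Definitions using (tri<; tri≈; tri>)
open import Relation.Binary.PropositionalEquality hiding ([_])
open import Relation.Nullary using (¬_; yes; no)
open import Relation.Nullary.Reflects using (ofʸ; ofⁿ)

-- Words and the order of consecutive letters

Word : Set
Word = List ℕ

Far : ℕ → ℕ → Set
Far a b = suc a < b ⊎ suc b < a

Consecutive : ℕ → ℕ → Set
Consecutive p q = p ≡ suc q ⊎ q ≡ suc p

-- Coarser than Knuth equivalence, yet fine enough to keep the order of consecutive letters.
infix 4 _~_
data _~_ : Word → Word → Set where
  ~refl  : ∀ {w} → w ~ w
  ~swap  : ∀ {a b w} → Far a b → a ∷ b ∷ w ~ b ∷ a ∷ w
  ~prep  : ∀ a {w w'} → w ~ w' → a ∷ w ~ a ∷ w'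
  ~trans : ∀ {u v w} → u ~ v → v ~ w → u ~ w

Far-sym : ∀ {a b} → Far a b → Far b a
Far-sym (inj₁ p) = inj₂ p
Far-sym (inj₂ p) = inj₁ p

¬Far-consecutive : ∀ {p q} → Consecutive p q → Far p q → ⊥
¬Far-consecutive (inj₁ refl) (inj₁ lt) = <-asym lt (<-trans ≤-refl ≤-refl)
¬Far-consecutive (inj₁ refl) (inj₂ lt) = <-irrefl refl lt
¬Far-consecutive (inj₂ refl) (inj₁ lt) = <-irrefl refl lt
¬Far-consecutive (inj₂ refl) (inj₂ lt) = <-asym lt (<-trans ≤-refl ≤-refl)

Far-between : ∀ {a b c} → a < b → b < c → Far a c
Far-between a<b b<c = inj₁ (≤-trans (s≤s a<b) b<c)

~sym : ∀ {u v} → u ~ v → v ~ u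
~sym ~refl        = ~refl
~sym (~swap f)    = ~swap (Far-sym f)
~sym (~prep a r)  = ~prep a (~sym r)
~sym (~trans r s) = ~trans (~sym s) (~sym r)

~-reflexive : ∀ {u v} → u ≡ v → u ~ v
~-reflexive refl = ~refl

~-++ˡ : ∀ u {v w} → v ~ w → u ++ v ~ u ++ w
~-++ˡ []      r = r
~-++ˡ (a ∷ u) r = ~prep a (~-++ˡ u r)

~-++ʳ : ∀ {u v} w → u ~ v → u ++ w ~ v ++ w
~-++ʳ w ~refl        = ~refl
~-++ʳ w (~swap f)    = ~swap f
~-++ʳ w (~prep a r)  = ~prep a (~-++ʳ w r)
~-++ʳ w (~trans r s) = ~trans (~-++ʳ w r) (~-++ʳ w s)

~-reverse : ∀ {u v} → u ~ v → reverse u ~ reverse v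
~-reverse ~refl = ~refl
~-reverse (~swap {a} {b} {w} f) =
  subst₂ _~_ (sym (reverse-++ (a ∷ b ∷ []) w)) (sym (reverse-++ (b ∷ a ∷ []) w))
    (~-++ˡ (reverse w) (~swap (Far-sym f)))
~-reverse (~prep a {w} {w'} r) =
  subst₂ _~_ (sym (unfold-reverse a w)) (sym (unfold-reverse a w')) (~-++ʳ [ a ] (~-reverse r))
~-reverse (~trans r s) = ~trans (~-reverse r) (~-reverse s)

~-moveRight : ∀ {a} u → All (Far a) u → a ∷ u ~ u ++ [ a ]
~-moveRight []      []       = ~refl
~-moveRight (b ∷ u) (f ∷ fs) = ~trans (~swap f) (~prep b (~-moveRight u fs))

~⇒↭ : ∀ {u v} → u ~ v → u ↭ v
~⇒↭ ~refl        = ↭-refl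
~⇒↭ (~swap f)    = ↭-swap _ _ ↭-refl
~⇒↭ (~prep a r)  = ↭-prep a (~⇒↭ r)
~⇒↭ (~trans r s) = ↭-trans (~⇒↭ r) (~⇒↭ s)

Unique-resp-↭ : ∀ {u v : Word} → u ↭ v → Unique u → Unique v
Unique-resp-↭ p = PermS.Unique-resp-↭ (setoid ℕ) (↭⇒↭ₛ p)

Unique-++⁻ˡ : ∀ (u : Word) {v} → Unique (u ++ v) → Unique u
Unique-++⁻ˡ []      _        = []
Unique-++⁻ˡ (a ∷ u) (p ∷ ps) = All.++⁻ˡ u p ∷ Unique-++⁻ˡ u ps

Unique-++⁻ʳ : ∀ (u : Word) {v} → Unique (u ++ v) → Unique v
Unique-++⁻ʳ []      ps       = ps
Unique-++⁻ʳ (a ∷ u) (p ∷ ps) = Unique-++⁻ʳ u ps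

Unique-++⇒disjoint : ∀ (u : Word) {v x} → Unique (u ++ v) → x ∈ u → x ∈ v → ⊥
Unique-++⇒disjoint (a ∷ u) (p ∷ ps) (here refl) x∈v = All.lookup p (∈-++⁺ʳ u x∈v) refl
Unique-++⇒disjoint (a ∷ u) (p ∷ ps) (there x∈u) x∈v = Unique-++⇒disjoint u ps x∈u x∈v

-- Some occurrence of `p` with an occurrence of `q` further right. Only on words with distinct
-- letters does this exclude the opposite order, see `Before-asym`.
data Before (p q : ℕ) : Word → Set where
  here  : ∀ {w} → q ∈ w → Before p q (p ∷ w)
  there : ∀ {a w} → Before p q w → Before p q (a ∷ w)

-- A swap changes the relative order of the two swapped letters only, and these are `Far`, hence not
-- consecutive.
Before-resp-~ : ∀ {p q u v} → Consecutive p q → u ~ v → Before p q u → Before p q v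
Before-resp-~ c ~refl b = b
Before-resp-~ c (~swap f) (here (here refl)) = ⊥-elim (¬Far-consecutive c f)
Before-resp-~ c (~swap f) (here (there q∈w)) = there (here q∈w)
Before-resp-~ c (~swap f) (there (here q∈w)) = here (there q∈w)
Before-resp-~ c (~swap f) (there (there b))  = there (there b)
Before-resp-~ c (~prep a r) (here q∈w) = here (∈-resp-↭ (~⇒↭ r) q∈w)
Before-resp-~ c (~prep a r) (there b)  = there (Before-resp-~ c r b)
Before-resp-~ c (~trans r s) b = Before-resp-~ c s (Before-resp-~ c r b)

Before⇒∈ˡ : ∀ {p q w} → Before p q w → p ∈ w
Before⇒∈ˡ (here _)  = here refl
Before⇒∈ˡ (there b) = there (Before⇒∈ˡ b)

Before⇒∈ʳ : ∀ {p q w} → Before p q w → q ∈ w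
Before⇒∈ʳ (here q∈w) = there q∈w
Before⇒∈ʳ (there b)  = there (Before⇒∈ʳ b)

Before-++ : ∀ {p q u v} → p ∈ u → q ∈ v → Before p q (u ++ v)
Before-++ {u = _ ∷ u} (here refl) q∈v = here (∈-++⁺ʳ u q∈v)
Before-++ (there p∈u) q∈v = there (Before-++ p∈u q∈v)

Before-++⁺ˡ : ∀ {p q u} v → Before p q u → Before p q (u ++ v)
Before-++⁺ˡ v (here q∈u) = here (∈-++⁺ˡ q∈u)
Before-++⁺ˡ v (there b)  = there (Before-++⁺ˡ v b)

Before-++⁺ʳ : ∀ {p q} u {v} → Before p q v → Before p q (u ++ v)
Before-++⁺ʳ []      b = b
Before-++⁺ʳ (_ ∷ u) b = there (Before-++⁺ʳ u b)

Before-insert : ∀ {p q} u {v} a → Before p q (u ++ v) → Before p q (u ++ a ∷ v)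
Before-insert []      a b         = there b
Before-insert (c ∷ u) a (there b) = there (Before-insert u a b)
Before-insert {q = q} (c ∷ u) {v} a (here q∈) with ∈-++⁻ u q∈
... | inj₁ q∈u = here (∈-++⁺ˡ q∈u)
... | inj₂ q∈v = here (∈-++⁺ʳ u (there q∈v))

Before-asym : ∀ {p q w} → Unique w → Before p q w → Before q p w → ⊥
Before-asym (a ∷ u) (here p∈w) (here q∈w) = All.lookup a q∈w refl
Before-asym (a ∷ u) (here p∈w) (there b)  = All.lookup a (Before⇒∈ʳ b) refl
Before-asym (a ∷ u) (there b) (here p∈w)  = All.lookup a (Before⇒∈ʳ b) refl
Before-asym (a ∷ u) (there b) (there b')  = Before-asym u b b'

∈-reverse⁺ : ∀ {x : ℕ} {w} → x ∈ w → x ∈ reverse w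
∈-reverse⁺ {w = w} = ∈-resp-↭ (↭-sym (↭-reverse w))

Before-reverse : ∀ {p q w} → Before p q w → Before q p (reverse w)
Before-reverse {p} {w = _ ∷ w} (here q∈w) =
  subst (Before _ _) (sym (unfold-reverse p w)) (Before-++ (∈-reverse⁺ q∈w) (here refl))
Before-reverse {w = a ∷ w} (there b) =
  subst (Before _ _) (sym (unfold-reverse a w)) (Before-++⁺ˡ [ a ] (Before-reverse b))

-- Row insertion and row deletion

Inc : List ℕ → Set
Inc = AllPairs _<_

-- The lower row may end first but the upper one may not, so that the weak decrease of row lengths
-- is encoded together with the increase down the columns.
data Below : List ℕ → List ℕ → Set where
  []  : ∀ {r} → Below r []
  _∷_ : ∀ {x y r s} → x < y → Below r s → Below (x ∷ r) (y ∷ s)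

firstRow : Tableau → List ℕ
firstRow []      = []
firstRow (r ∷ _) = r

data IsTab : Tableau → Set where
  []  : IsTab []
  row : ∀ {r rs} → 0 < length r → Inc r → Below r (firstRow rs) → IsTab rs → IsTab (r ∷ rs)

-- The row reading word, bottom row first. For `transpose T` it lists the columns of `T` from right
-- to left, each downwards, so its `reverse` is the column reading word of `T`.
word : Tableau → Word
word []       = []
word (r ∷ rs) = word rs ++ r

data Bump (x : ℕ) : List ℕ → List ℕ → ℕ → Set where
  stop : ∀ {y ys} → x < y → Bump x (y ∷ ys) (x ∷ ys) y
  go   : ∀ {z zs zs' y} → z < x → Bump x zs zs' y → Bump x (z ∷ zs) (z ∷ zs') y

bumpRow-view : ∀ x r → All (x ≢_) r →
  (All (_< x) r × bumpRow x r ≡ (r ++ [ x ] , nothing)) ⊎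
  (∃ λ r' → ∃ λ y → Bump x r r' y × bumpRow x r ≡ (r' , just y))
bumpRow-view x [] [] = inj₁ ([] , refl)
bumpRow-view x (y ∷ ys) (x≢y ∷ x∉) with x <ᵇ y | <ᵇ-reflects-< x y
... | true  | ofʸ x<y = inj₂ (x ∷ ys , y , stop x<y , refl)
... | false | ofⁿ x≮y with bumpRow x ys | bumpRow-view x ys x∉
...   | _ | inj₁ (lt , refl) = inj₁ (≤∧≢⇒< (≮⇒≥ x≮y) (≢-sym x≢y) ∷ lt , refl)
...   | _ | inj₂ (r' , z , b , refl) =
  inj₂ (y ∷ r' , z , go (≤∧≢⇒< (≮⇒≥ x≮y) (≢-sym x≢y)) b , refl)

Bump-< : ∀ {x r r' y} → Bump x r r' y → x < y
Bump-< (stop x<y) = x<y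
Bump-< (go _ b)   = Bump-< b

Bump-nonEmpty : ∀ {x r r' y} → Bump x r r' y → 0 < length r'
Bump-nonEmpty (stop _) = s≤s z≤n
Bump-nonEmpty (go _ _) = s≤s z≤n

Bump-All : ∀ {P : ℕ → Set} {x r r' y} → Bump x r r' y → P x → All P r → All P r'
Bump-All (stop _) px (_ ∷ ps) = px ∷ ps
Bump-All (go _ b) px (p ∷ ps) = p ∷ Bump-All b px ps

Bump-Inc : ∀ {x r r' y} → Bump x r r' y → Inc r → Inc r'
Bump-Inc (stop x<y) (a ∷ i) = All.map (<-trans x<y) a ∷ i
Bump-Inc (go z<x b) (a ∷ i) = Bump-All b z<x a ∷ Bump-Inc b i

-- The letter `x` moves left past entries above `y`, and then `y` moves left past entries below `x`.
-- As `x < y`, one of the two always lies strictly between the letters being swapped, which are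
-- therefore `Far`.
Bump-word : ∀ {x r r' y} → Bump x r r' y → Inc r → r ++ [ x ] ~ y ∷ r'
Bump-word {r = y ∷ ys} (stop x<y) (a ∷ i) =
  ~prep y (~sym (~-moveRight ys (All.map (Far-between x<y) a)))
Bump-word {r = z ∷ zs} (go z<x b) (a ∷ i) =
  ~trans (~prep z (Bump-word b i)) (~swap (Far-between z<x (Bump-< b)))

Bump-Belowˡ : ∀ {x r r' y s} → Bump x r r' y → Below r s → Below r' s
Bump-Belowˡ b          []       = []
Bump-Belowˡ (stop x<y) (p ∷ bl) = <-trans x<y p ∷ bl
Bump-Belowˡ (go _ b)   (p ∷ bl) = p ∷ Bump-Belowˡ b bl

-- The entry of `s` under the old place of `y` exceeds `y`, so `y` lands in its old column or
-- further left, where the entries above it are smaller.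
Bump-Below : ∀ {x r r' y s} → Bump x r r' y → Below r s → Below r' (proj₁ (bumpRow y s))
Bump-Below (stop x<y) []           = x<y ∷ []
Bump-Below (go z<x b) []           = <-trans z<x (Bump-< b) ∷ []
Bump-Below {y = y} (stop x<y) (_∷_ {y = c} p bl) with y <ᵇ c | <ᵇ-reflects-< y c
... | true  | _       = x<y ∷ bl
... | false | ofⁿ y≮c = ⊥-elim (y≮c p)
Bump-Below {y = y} (go z<x b) (_∷_ {y = c} {s = s} p bl) with y <ᵇ c
... | true  = <-trans z<x (Bump-< b) ∷ Bump-Belowˡ b bl
... | false with bumpRow y s | Bump-Below b bl
...   | _ | ih = p ∷ ih

Inc-∷ʳ : ∀ {r x} → Inc r → All (_< x) r → Inc (r ++ [ x ])
Inc-∷ʳ []      []       = [] ∷ []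
Inc-∷ʳ (a ∷ i) (p ∷ ps) = All.++⁺ a (p ∷ []) ∷ Inc-∷ʳ i ps

Below-++ : ∀ {r s} u → Below r s → Below (r ++ u) s
Below-++ u []       = []
Below-++ u (p ∷ bl) = p ∷ Below-++ u bl

nonEmpty-∷ʳ : ∀ (r : List ℕ) x → 0 < length (r ++ [ x ])
nonEmpty-∷ʳ []      x = s≤s z≤n
nonEmpty-∷ʳ (_ ∷ _) x = s≤s z≤n

firstRow-rowInsert : ∀ y rs → firstRow (rowInsert y rs) ≡ proj₁ (bumpRow y (firstRow rs))
firstRow-rowInsert y []       = refl
firstRow-rowInsert y (r ∷ rs) with bumpRow y r
... | _ , nothing = refl
... | _ , just _  = refl

-- `Bump-word` moves the bumped letter to the left of the new row, where it is the letter appended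
-- to the reading word of the rows below. Distinctness passes to these rows because `~` only
-- permutes letters; it makes every comparison strict.
rowInsert-IsTab×word : ∀ x {U} → IsTab U → Unique (word U ++ [ x ]) →
  IsTab (rowInsert x U) × word U ++ [ x ] ~ word (rowInsert x U)
rowInsert-IsTab×word x [] _ = row (s≤s z≤n) ([] ∷ []) [] [] , ~refl
rowInsert-IsTab×word x (row {r} {rs} ne inc bl t) u with bumpRow-view x r x∉r
  where
  x∉r : All (x ≢_) r
  x∉r = All.tabulate λ y∈r x≡y →
    Unique-++⇒disjoint (word rs ++ r) u (∈-++⁺ʳ (word rs) y∈r) (here (sym x≡y))
... | inj₁ (lt , eq) rewrite eq =
  row (nonEmpty-∷ʳ r x) (Inc-∷ʳ inc lt) (Below-++ [ x ] bl) t ,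
  ~-reflexive (++-assoc (word rs) r [ x ])
... | inj₂ (r' , y , b , eq) rewrite eq =
  row (Bump-nonEmpty b) (Bump-Inc b inc)
      (subst (Below r') (sym (firstRow-rowInsert y rs)) (Bump-Below b bl)) (proj₁ ih) ,
  ~trans step (~-++ʳ r' (proj₂ ih))
  where
  step : (word rs ++ r) ++ [ x ] ~ (word rs ++ [ y ]) ++ r'
  step = ~trans (~-reflexive (++-assoc (word rs) r [ x ]))
        (~trans (~-++ˡ (word rs) (Bump-word b inc))
                (~-reflexive (sym (++-assoc (word rs) [ y ] r'))))
  ih = rowInsert-IsTab×word y t (Unique-++⁻ˡ (word rs ++ [ y ]) (Unique-resp-↭ (~⇒↭ step) u))

-- The side condition of `stop` makes the replaced entry the last one smaller than `y`.
data Unbump (y : ℕ) : List ℕ → List ℕ → ℕ → Set where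
  stop : ∀ {z ws} → z < y → All (y <_) ws → Unbump y (z ∷ ws) (y ∷ ws) z
  go   : ∀ {z ws ws' o} → z < y → Unbump y ws ws' o → Unbump y (z ∷ ws) (z ∷ ws') o

Unbump-exists : ∀ {y z zs} → z < y → Inc (z ∷ zs) → All (y ≢_) zs →
  ∃ λ r' → ∃ λ o → Unbump y (z ∷ zs) r' o
Unbump-exists {zs = []} z<y _ _ = _ , _ , stop z<y []
Unbump-exists {y} {zs = w ∷ ws} z<y (_ ∷ (a ∷ i)) (y≢w ∷ y∉) with <-cmp w y
... | tri< w<y _ _ = let r' , o , b = Unbump-exists w<y (a ∷ i) y∉ in _ , _ , go z<y b
... | tri≈ _ w≡y _ = ⊥-elim (y≢w (sym w≡y))
... | tri> _ _ y<w = _ , _ , stop z<y (y<w ∷ All.map (<-trans y<w) a)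

Unbump⇒unbump : ∀ {y r r' z} → Unbump y r r' z → unbump y r ≡ (r' , z)
Unbump⇒unbump (stop {ws = []} z<y []) = refl
Unbump⇒unbump {y} (stop {ws = w ∷ ws} z<y (y<w ∷ _)) with w <ᵇ y | <ᵇ-reflects-< w y
... | false | _       = refl
... | true  | ofʸ w<y = ⊥-elim (<-asym y<w w<y)
Unbump⇒unbump {y} (go {ws = w ∷ ws} z<y b) with w <ᵇ y | <ᵇ-reflects-< w y
... | false | ofⁿ w≮y = ⊥-elim (w≮y (Unbump-head b))
  where
  Unbump-head : ∀ {w ws r' z} → Unbump y (w ∷ ws) r' z → w < y
  Unbump-head (stop lt _) = lt
  Unbump-head (go lt _)   = lt
... | true  | _ with unbump' y w ws | Unbump⇒unbump b
...   | _ | refl = refl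

Unbump-< : ∀ {y r r' z} → Unbump y r r' z → z < y
Unbump-< (stop z<y _) = z<y
Unbump-< (go _ b)     = Unbump-< b

Unbump-length : ∀ {y r r' z} → Unbump y r r' z → length r' ≡ length r
Unbump-length (stop _ _) = refl
Unbump-length (go _ b)   = cong suc (Unbump-length b)

Unbump-All : ∀ {P : ℕ → Set} {y r r' z} → Unbump y r r' z → P y → All P r → All P r'
Unbump-All (stop _ _) py (_ ∷ ps) = py ∷ ps
Unbump-All (go _ b)   py (p ∷ ps) = p ∷ Unbump-All b py ps

Unbump-∈ : ∀ {y r r' z} → Unbump y r r' z → z ∈ r
Unbump-∈ (stop _ _) = here refl
Unbump-∈ (go _ b)   = there (Unbump-∈ b)

Unbump-∈' : ∀ {y r r' z} → Unbump y r r' z → y ∈ r'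
Unbump-∈' (stop _ _) = here refl
Unbump-∈' (go _ b)   = there (Unbump-∈' b)

-- Entries after `z` exceed `y`, and those before it are smaller than `z`. This is what compares two
-- routes row by row in `Del-Del`.
Unbump-max : ∀ {y r r' z} → Unbump y r r' z → Inc r → ∀ {w} → w ∈ r → w < y → w ≤ z
Unbump-max (stop _ _)  _       (here refl)  _   = ≤-refl
Unbump-max (stop _ gt) _       (there w∈ws) w<y = ⊥-elim (<-asym w<y (All.lookup gt w∈ws))
Unbump-max (go _ b)    (a ∷ i) (here refl)  _   = <⇒≤ (All.lookup a (Unbump-∈ b))
Unbump-max (go _ b)    (a ∷ i) (there w∈ws) w<y = Unbump-max b i w∈ws w<y

Unbump-old : ∀ {y r r' z} → Unbump y r r' z → Inc r → ∀ {w} → w ∈ r' → w ≢ y → w ∈ r × w ≢ z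
Unbump-old (stop _ _) _       (here refl)  w≢y = ⊥-elim (w≢y refl)
Unbump-old (stop _ _) (a ∷ i) (there w∈ws) w≢y =
  there w∈ws , λ w≡z → <-irrefl (sym w≡z) (All.lookup a w∈ws)
Unbump-old (go _ b)   (a ∷ i) (here refl)  w≢y =
  here refl , λ w≡o → <-irrefl w≡o (All.lookup a (Unbump-∈ b))
Unbump-old (go _ b)   (a ∷ i) (there w∈)   w≢y =
  let w∈r , w≢o = Unbump-old b i w∈ w≢y in there w∈r , w≢o

Unbump-Inc : ∀ {y r r' z} → Unbump y r r' z → Inc r → Inc r'
Unbump-Inc (stop _ gt) (_ ∷ i) = gt ∷ i
Unbump-Inc (go z<y b)  (a ∷ i) = Unbump-All b z<y a ∷ Unbump-Inc b i

-- The mirror image of `Bump-word`: `y` moves right past entries below `z`, and `z` then moves right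
-- past entries above `y`.
Unbump-word : ∀ {y r r' z} → Unbump y r r' z → Inc r → y ∷ r ~ r' ++ [ z ]
Unbump-word {y} (stop {ws = ws} z<y gt) _ =
  ~prep y (~-moveRight ws (All.map (Far-between z<y) gt))
Unbump-word (go {z} z<y b) (a ∷ i) =
  ~trans (~swap (Far-sym (Far-between (All.lookup a (Unbump-∈ b)) (Unbump-< b))))
         (~prep z (Unbump-word b i))

-- What the row above sees of a deletion that turns the row s into s' and sends y up.
data Drop : List ℕ → List ℕ → ℕ → Set where
  last  : ∀ {y} → Drop [ y ] [] y
  repl  : ∀ {y y' s} → y < y' → Drop (y ∷ s) (y' ∷ s) y
  there : ∀ {a s s' y} → Drop s s' y → Drop (a ∷ s) (a ∷ s') y

Drop-∈ : ∀ {s s' y} → Drop s s' y → y ∈ s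
Drop-∈ last      = here refl
Drop-∈ (repl _)  = here refl
Drop-∈ (there d) = there (Drop-∈ d)

Drop-∷ʳ : ∀ r y → Drop (r ++ [ y ]) r y
Drop-∷ʳ []      y = last
Drop-∷ʳ (_ ∷ r) y = there (Drop-∷ʳ r y)

Unbump⇒Drop : ∀ {y r r' z} → Unbump y r r' z → Drop r r' z
Unbump⇒Drop (stop z<y _) = repl z<y
Unbump⇒Drop (go _ b)     = there (Unbump⇒Drop b)

Below-∈ : ∀ {r s y} → Below r s → y ∈ s → ∃ λ w → w ∈ r × w < y
Below-∈ (p ∷ bl) (here refl) = _ , here refl , p
Below-∈ (p ∷ bl) (there y∈s) = let w , w∈r , w<y = Below-∈ bl y∈s in w , there w∈r , w<y

Unbump-raise : ∀ {y r r' z s} → Unbump y r r' z → All (y <_) s → Below r s → Below r' s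
Unbump-raise b          _        []       = []
Unbump-raise (stop _ _) (q ∷ qs) (p ∷ bl) = q ∷ bl
Unbump-raise (go _ b)   (q ∷ qs) (p ∷ bl) = p ∷ Unbump-raise b qs bl

-- The entry of `r` above `y` is smaller than `y`, so `y` moves up into its own column or further
-- right. Had it stopped further left, that entry would have to exceed `y`. Where `y` raises an
-- entry of `r`, the entries of `s` below lie to the right of `y` and stay larger.
Unbump-Below : ∀ {y r r' z s s'} → Unbump y r r' z → Drop s s' y → Inc s → Below r s → Below r' s'
Unbump-Below b last _ _ = []
Unbump-Below (stop _ _) (repl y<y') _ (p ∷ bl) = y<y' ∷ bl
Unbump-Below (go z<y b) (repl y<y') (a ∷ i) (p ∷ bl) = <-trans z<y y<y' ∷ Unbump-raise b a bl
Unbump-Below (stop _ gt) (there d) i (p ∷ bl) =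
  let w , w∈ , w<y = Below-∈ bl (Drop-∈ d) in ⊥-elim (<-asym w<y (All.lookup gt w∈))
Unbump-Below (go _ b) (there d) (_ ∷ i) (p ∷ bl) = p ∷ Unbump-Below b d i bl

-- The graph of rowDelete, recursive from the top row down instead of along a reversed prefix.
data Del : ℕ → Tableau → Tableau → ℕ → Set where
  top₁ : ∀ {y} → Del 0 ([ y ] ∷ []) [] y
  top₂ : ∀ {r r₀ y rs} → r ≡ r₀ ++ [ y ] → 0 < length r₀ → length (firstRow rs) ≤ length r₀ →
         Del 0 (r ∷ rs) (r₀ ∷ rs) y
  down : ∀ {j r r' rs rs' y z} → Del j rs rs' y → Unbump y r r' z →
         Del (suc j) (r ∷ rs) (r' ∷ rs') z

Del⇒Drop : ∀ {j U U' x} → Del j U U' x → Drop (firstRow U) (firstRow U') x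
Del⇒Drop top₁ = last
Del⇒Drop (top₂ {r₀ = r₀} {y} refl _ _) = Drop-∷ʳ r₀ y
Del⇒Drop (down _ b) = Unbump⇒Drop b

Inc-firstRow : ∀ {U} → IsTab U → Inc (firstRow U)
Inc-firstRow []             = []
Inc-firstRow (row _ i _ _) = i

Inc-∷ʳ⁻ : ∀ r {x} → Inc (r ++ [ x ]) → Inc r × All (_< x) r
Inc-∷ʳ⁻ []      _       = [] , []
Inc-∷ʳ⁻ (y ∷ r) (a ∷ i) =
  let i' , lt = Inc-∷ʳ⁻ r i in
  All.++⁻ˡ r a ∷ i' , All.lookup a (∈-++⁺ʳ r (here refl)) ∷ lt

Below-∷ʳ⁻ : ∀ r {x s} → Below (r ++ [ x ]) s → length s ≤ length r → Below r s
Below-∷ʳ⁻ []      {s = []} _        _         = []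
Below-∷ʳ⁻ (y ∷ r) []       _         = []
Below-∷ʳ⁻ (y ∷ r) (p ∷ bl) (s≤s len) = p ∷ Below-∷ʳ⁻ r bl len

Del-IsTab : ∀ {j U U' x} → Del j U U' x → IsTab U → IsTab U'
Del-IsTab top₁ _ = []
Del-IsTab (top₂ {r₀ = r₀} refl ne len) (row _ i bl t) =
  row ne (proj₁ (Inc-∷ʳ⁻ r₀ i)) (Below-∷ʳ⁻ r₀ bl len) t
Del-IsTab (down d b) (row ne i bl t) =
  row (subst (0 <_) (sym (Unbump-length b)) ne) (Unbump-Inc b i)
      (Unbump-Below b (Del⇒Drop d) (Inc-firstRow t) bl) (Del-IsTab d t)

Del-word : ∀ {j U U' x} → Del j U U' x → IsTab U → word U ~ word U' ++ [ x ]
Del-word top₁ _ = ~refl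
Del-word (top₂ {r₀ = r₀} {y} {rs} refl _ _) _ = ~-reflexive (sym (++-assoc (word rs) r₀ [ y ]))
Del-word (down {r = r} {r'} {rs} {rs'} {y} {z} d b) (row _ i _ t) =
  ~trans (~-++ʳ r (Del-word d t))
 (~trans (~-reflexive (++-assoc (word rs') [ y ] r))
 (~trans (~-++ˡ (word rs') (Unbump-word b i))
         (~-reflexive (sym (++-assoc (word rs') r' [ z ])))))

-- Two successive routes do not cross. If the second brings the larger letter into a row, the letter
-- left there by the first route is available to it, so it ejects at least that one. If it brings
-- the smaller letter, it ejects an old entry, and the first route had already ejected the largest
-- candidate.
Del-Del : ∀ {j₁ j₂ U U₁ U₂ x y} → IsTab U → Del j₁ U U₁ x → Del j₂ U₁ U₂ y →
  (j₂ < j₁ × x < y) ⊎ (j₁ ≤ j₂ × y < x)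
Del-Del (row _ i _ _) (top₂ {r₀ = r₀} refl _ _) d = inj₂ (z≤n , All.lookup (proj₂ (Inc-∷ʳ⁻ r₀ i)) (y∈ d))
  where
  y∈ : ∀ {j rs U₂ y} → Del j (r₀ ∷ rs) U₂ y → y ∈ r₀
  y∈ d = Drop-∈ (Del⇒Drop d)
Del-Del _ (down d b) top₁ with Unbump-∈' b
... | here refl = inj₁ (s≤s z≤n , Unbump-< b)
Del-Del (row _ i _ _) (down d b) (top₂ {r₀ = r₀} refl _ _) with ∈-++⁻ r₀ (Unbump-∈' b)
... | inj₂ (here refl) = inj₁ (s≤s z≤n , Unbump-< b)
... | inj₁ x₁∈r₀ =
  inj₁ (s≤s z≤n , <-trans (Unbump-< b) (All.lookup (proj₂ (Inc-∷ʳ⁻ r₀ (Unbump-Inc b i))) x₁∈r₀))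
Del-Del (row _ i _ t) (down d₁ b₁) (down d₂ b₂) with Del-Del t d₁ d₂
... | inj₁ (j₂<j₁ , x<y) = inj₁ (s≤s j₂<j₁ ,
  <-≤-trans (Unbump-< b₁) (Unbump-max b₂ (Unbump-Inc b₁ i) (Unbump-∈' b₁) x<y))
... | inj₂ (j₁≤j₂ , y<x) = inj₂ (s≤s j₁≤j₂ , ≤∧≢⇒< (Unbump-max b₁ i (proj₁ old) z'<x) (proj₂ old))
  where
  z'<x = <-trans (Unbump-< b₂) y<x
  old  = Unbump-old b₁ i (Unbump-∈ b₂) (λ z'≡x → <-irrefl z'≡x z'<x)

-- Shapes, transposition and positions of entries

hd : List ℕ → ℕ
hd []      = 0
hd (x ∷ _) = x

-- `IsPartition` in a form that recurses on a single list; the default `hd [] = 0` covers the last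
-- row.
data Part : List ℕ → Set where
  []   : Part []
  part : ∀ {x xs} → 0 < x → hd xs ≤ x → Part xs → Part (x ∷ xs)

IsPartition⇒Part : ∀ {μ} → IsPartition μ → Part μ
IsPartition⇒Part (_ , [])               = []
IsPartition⇒Part ([-] , p ∷ [])         = part p z≤n []
IsPartition⇒Part (x≥y ∷ l , p ∷ q ∷ ps) = part p x≥y (IsPartition⇒Part (l , q ∷ ps))

-- Counting from 0, this is also the column of a box added at the end of row `i`, and hence the row
-- of that box in the transpose.
rowLen : ℕ → List ℕ → ℕ
rowLen _       []       = 0
rowLen zero    (x ∷ _)  = x
rowLen (suc i) (_ ∷ xs) = rowLen i xs

hd-shape : ∀ T → hd (shape T) ≡ length (firstRow T)
hd-shape []      = refl
hd-shape (_ ∷ _) = refl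

rowLen≤hd : ∀ i {μ} → Part μ → rowLen i μ ≤ hd μ
rowLen≤hd i       []           = z≤n
rowLen≤hd zero    (part _ _ _) = ≤-refl
rowLen≤hd (suc i) (part _ h p) = ≤-trans (rowLen≤hd i p) h

rowLen-addBox : ∀ i μ → rowLen i (addBox i μ) ≡ suc (rowLen i μ)
rowLen-addBox zero    []      = refl
rowLen-addBox zero    (_ ∷ _) = refl
rowLen-addBox (suc i) []      = rowLen-addBox i []
rowLen-addBox (suc i) (_ ∷ μ) = rowLen-addBox i μ

rowLen-addBox-≢ : ∀ i j μ → i ≢ j → rowLen i (addBox j μ) ≡ rowLen i μ
rowLen-addBox-≢ zero    zero    μ       i≢j = ⊥-elim (i≢j refl)
rowLen-addBox-≢ (suc _) zero    []      _   = refl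
rowLen-addBox-≢ (suc _) zero    (_ ∷ _) _   = refl
rowLen-addBox-≢ zero    (suc _) []      _   = refl
rowLen-addBox-≢ zero    (suc _) (_ ∷ _) _   = refl
rowLen-addBox-≢ (suc i) (suc j) []      i≢j = rowLen-addBox-≢ i j [] (λ e → i≢j (cong suc e))
rowLen-addBox-≢ (suc i) (suc j) (_ ∷ μ) i≢j = rowLen-addBox-≢ i j μ (λ e → i≢j (cong suc e))

rowLen-anti : ∀ {i j μ} → Part μ → i ≤ j → rowLen j μ ≤ rowLen i μ
rowLen-anti               []           _         = z≤n
rowLen-anti {zero} {j}    p@(part _ _ _) _       = rowLen≤hd j p
rowLen-anti {suc i} {suc j} (part _ _ p) (s≤s l) = rowLen-anti p l

shape-addEntry : ∀ i k T → shape (addEntry i k T) ≡ addBox i (shape T)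
shape-addEntry zero    k []      = refl
shape-addEntry zero    k (r ∷ T) = cong (_∷ shape T) (trans (length-++ r) (+-comm (length r) 1))
shape-addEntry (suc i) k []      = cong (0 ∷_) (shape-addEntry i k [])
shape-addEntry (suc i) k (r ∷ T) = cong (length r ∷_) (shape-addEntry i k T)

IsTab⇒Part : ∀ {T} → IsTab T → Part (shape T)
IsTab⇒Part []                    = []
IsTab⇒Part (row {r} {rs} ne _ bl t) =
  part ne (subst (_≤ length r) (sym (hd-shape rs)) (Below-length bl)) (IsTab⇒Part t)
  where
  Below-length : ∀ {r s} → Below r s → length s ≤ length r
  Below-length []       = z≤n
  Below-length (_ ∷ bl) = s≤s (Below-length bl)

zipLong-length : ∀ r C → length C ≤ length r → length (zipLong r C) ≡ length r
zipLong-length []      []      _       = refl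
zipLong-length (x ∷ r) []      _       = cong suc (zipLong-length r [] z≤n)
zipLong-length (x ∷ r) (c ∷ C) (s≤s l) = cong suc (zipLong-length r C l)

transpose-length : ∀ T → Part (shape T) → length (transpose T) ≡ hd (shape T)
transpose-length≤ : ∀ r T → Part (length r ∷ shape T) → length (transpose T) ≤ length r
transpose-length []      _ = refl
transpose-length (r ∷ T) p = zipLong-length r (transpose T) (transpose-length≤ r T p)
transpose-length≤ r T (part _ h p) = ≤-trans (≤-reflexive (transpose-length T p)) h

-- `zipLong` makes `r` the first column, which transposition turns into the first row. An empty `r`
-- would leave no row behind, so the induction stops at rows of length one.
transpose-zipLong : ∀ r C → 0 < length r → length C ≤ length r →
  transpose (zipLong r C) ≡ r ∷ transpose C
transpose-zipLong (x ∷ [])     []       _ _ = refl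
transpose-zipLong (x ∷ [])     (c ∷ []) _ _ = refl
transpose-zipLong (x ∷ [])     (c ∷ d ∷ C) _ (s≤s ())
transpose-zipLong (x ∷ y ∷ r)  []       _ _
  rewrite transpose-zipLong (y ∷ r) [] (s≤s z≤n) z≤n = refl
transpose-zipLong (x ∷ y ∷ r)  (c ∷ C)  _ (s≤s l)
  rewrite transpose-zipLong (y ∷ r) C (s≤s z≤n) l = refl

transpose-involutive : ∀ T → Part (shape T) → transpose (transpose T) ≡ T
transpose-involutive []      _ = refl
transpose-involutive (r ∷ T) p@(part ne _ p') =
  trans (transpose-zipLong r (transpose T) ne (transpose-length≤ r T p))
        (cong (r ∷_) (transpose-involutive T p'))

zipLong-shape : ∀ r r' C C' → length r ≡ length r' → shape C ≡ shape C' →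
  shape (zipLong r C) ≡ shape (zipLong r' C')
zipLong-shape []      []        C       C'        _ e = e
zipLong-shape (x ∷ r) (x' ∷ r') []      []        l e =
  cong (1 ∷_) (zipLong-shape r r' [] [] (suc-injective l) e)
zipLong-shape (x ∷ r) (x' ∷ r') (c ∷ C) (c' ∷ C') l e =
  cong₂ _∷_ (cong suc (∷-injectiveˡ e))
            (zipLong-shape r r' C C' (suc-injective l) (∷-injectiveʳ e))

-- This replaces conjugation of partitions: the shape of a transpose depends on the shape alone.
transpose-shape : ∀ T T' → shape T ≡ shape T' → shape (transpose T) ≡ shape (transpose T')
transpose-shape []      []        _ = refl
transpose-shape (r ∷ T) (r' ∷ T') e =
  zipLong-shape r r' (transpose T) (transpose T') (∷-injectiveˡ e)
                (transpose-shape T T' (∷-injectiveʳ e))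

-- What lets `r` be prefixed to `C` as a new first column with all rows still increasing.
data Above : List ℕ → Tableau → Set where
  []  : ∀ {r} → Above r []
  _∷_ : ∀ {x y r c C} → x < y → Above r C → Above (x ∷ r) ((y ∷ c) ∷ C)

Above-zipLong : ∀ {r s} C → Below r s → length C ≤ length s → Above r (zipLong s C)
Above-zipLong []      []       _       = []
Above-zipLong []      (p ∷ bl) _       = p ∷ Above-zipLong [] bl z≤n
Above-zipLong (c ∷ C) (p ∷ bl) (s≤s l) = p ∷ Above-zipLong C bl l

Below-zipLong : ∀ {x q r C} → All (x <_) r → Below q (firstRow C) → Above r C →
  Below (x ∷ q) (firstRow (zipLong r C))
Below-zipLong {r = []}    _       _        [] = []
Below-zipLong {r = _ ∷ _} (l ∷ _) _        [] = l ∷ []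
Below-zipLong {r = _ ∷ _} (l ∷ _) bl (_ ∷ ab) = l ∷ bl

IsTab-zipLong : ∀ {r C} → Inc r → Above r C → IsTab C → IsTab (zipLong r C)
IsTab-zipLong [] [] [] = []
IsTab-zipLong (a ∷ i) [] [] =
  row (s≤s z≤n) ([] ∷ []) (Below-zipLong {q = []} a [] []) (IsTab-zipLong i [] [])
IsTab-zipLong (a ∷ i) (p ∷ ab) (row _ (b ∷ j) bl t) =
  row (s≤s z≤n) ((p ∷ All.map (<-trans p) b) ∷ b ∷ j) (Below-zipLong a bl ab) (IsTab-zipLong i ab t)

transpose-IsTab : ∀ {T} → IsTab T → IsTab (transpose T)
transpose-IsTab [] = []
transpose-IsTab (row {r} {rs} _ i bl t) = IsTab-zipLong i (above rs bl t) (transpose-IsTab t)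
  where
  above : ∀ rs → Below r (firstRow rs) → IsTab rs → Above r (transpose rs)
  above []       _  _ = []
  above (s ∷ ss) bl t = Above-zipLong (transpose ss) bl (transpose-length≤ s ss (IsTab⇒Part t))

zipLong-addEntry : ∀ r C j k → j < length r → j ≤ length C →
  zipLong r (addEntry j k C) ≡ addEntry j k (zipLong r C)
zipLong-addEntry (x ∷ r) []      zero    k _       _       = refl
zipLong-addEntry (x ∷ r) (c ∷ C) zero    k _       _       = refl
zipLong-addEntry (x ∷ r) (c ∷ C) (suc j) k (s≤s l) (s≤s m) =
  cong ((x ∷ c) ∷_) (zipLong-addEntry r C j k l m)

zipLong-∷ʳ : ∀ r C k → length C ≤ length r →
  zipLong (r ++ [ k ]) C ≡ addEntry (length r) k (zipLong r C)
zipLong-∷ʳ []      []      k _       = refl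
zipLong-∷ʳ (x ∷ r) []      k _       = cong ([ x ] ∷_) (zipLong-∷ʳ r [] k z≤n)
zipLong-∷ʳ (x ∷ r) (c ∷ C) k (s≤s l) = cong ((x ∷ c) ∷_) (zipLong-∷ʳ r C k l)

-- Below the first row, the column of the new box is already headed by an entry of `r`, because the
-- enlarged shape is still a partition. So prefixing `r` as a column commutes with adding the entry.
transpose-addEntry : ∀ i k T → Part (shape T) → Part (addBox i (shape T)) →
  transpose (addEntry i k T) ≡ addEntry (rowLen i (shape T)) k (transpose T)
transpose-addEntry zero    k []      _ _ = refl
transpose-addEntry (suc i) k []      _ (part () _ _)
transpose-addEntry zero    k (r ∷ T) p _ = zipLong-∷ʳ r (transpose T) k (transpose-length≤ r T p)
transpose-addEntry (suc i) k (r ∷ T) (part _ _ p) (part _ h q) =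
  trans (cong (zipLong r) (transpose-addEntry i k T p q))
        (zipLong-addEntry r (transpose T) (rowLen i (shape T)) k
          (≤-trans (≤-reflexive (sym (rowLen-addBox i (shape T)))) (≤-trans (rowLen≤hd i q) h))
          (≤-trans (rowLen≤hd i p) (≤-reflexive (sym (transpose-length T p)))))

word-addEntry : ∀ j k U → ∃ λ u → ∃ λ v → word U ≡ u ++ v × word (addEntry j k U) ≡ u ++ k ∷ v
word-addEntry zero    k []      = [] , [] , refl , refl
word-addEntry zero    k (r ∷ U) =
  word U ++ r , [] , sym (++-identityʳ _) , sym (++-assoc (word U) r [ k ])
word-addEntry (suc j) k []      =
  let u , v , e , e' = word-addEntry j k []
  in u , v , e , trans (++-identityʳ _) e'
word-addEntry (suc j) k (r ∷ U) =
  let u , v , e , e' = word-addEntry j k U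
  in u , v ++ r , trans (cong (_++ r) e) (++-assoc u v r) , trans (cong (_++ r) e') (++-assoc u (k ∷ v) r)

Below-∷ʳ : ∀ {r s k} → Below r s → length s < length r → All (_< k) r → Below r (s ++ [ k ])
Below-∷ʳ {x ∷ r} []       _       (x<k ∷ _)  = x<k ∷ []
Below-∷ʳ         (p ∷ bl) (s≤s l) (_ ∷ r<k) = p ∷ Below-∷ʳ bl l r<k

addEntry-IsTab : ∀ i {k T} → IsTab T → All (_< k) (word T) → Part (addBox i (shape T)) →
  IsTab (addEntry i k T)
addEntry-IsTab zero    []                    _  _             = row (s≤s z≤n) ([] ∷ []) [] []
addEntry-IsTab (suc i) []                    _  (part () _ _)
addEntry-IsTab zero {k} (row {r} {rs} _ inc bl t) lt _ =
  row (nonEmpty-∷ʳ r k) (Inc-∷ʳ inc (All.++⁻ʳ (word rs) lt)) (Below-++ [ k ] bl) t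
addEntry-IsTab (suc i) {k} (row {r} {rs} ne inc bl t) lt (part _ h p) =
  row ne inc (below i rs h bl) (addEntry-IsTab i t (All.++⁻ˡ (word rs) lt) p)
  where
  below : ∀ i rs → hd (addBox i (shape rs)) ≤ length r → Below r (firstRow rs) →
          Below r (firstRow (addEntry i k rs))
  below zero    []       h bl = Below-∷ʳ bl h (All.++⁻ʳ (word rs) lt)
  below zero    (s ∷ ss) h bl = Below-∷ʳ bl h (All.++⁻ʳ (word rs) lt)
  below (suc i) []       _ bl = []
  below (suc i) (s ∷ ss) _ bl = bl

data Nth : List ℕ → ℕ → ℕ → Set where
  here  : ∀ {x r} → Nth (x ∷ r) 0 x
  there : ∀ {x y r j} → Nth r j x → Nth (y ∷ r) (suc j) x

-- The row index comes first, then the column index, both from 0; transposition exchanges them.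
data At : Tableau → ℕ → ℕ → ℕ → Set where
  here  : ∀ {r rs j x} → Nth r j x → At (r ∷ rs) 0 j x
  there : ∀ {r rs i j x} → At rs i j x → At (r ∷ rs) (suc i) j x

Nth⇒∈ : ∀ {r j x} → Nth r j x → x ∈ r
Nth⇒∈ here      = here refl
Nth⇒∈ (there n) = there (Nth⇒∈ n)

∈⇒Nth : ∀ {r x} → x ∈ r → ∃ λ j → Nth r j x
∈⇒Nth (here refl) = 0 , here
∈⇒Nth (there x∈r) = let j , n = ∈⇒Nth x∈r in suc j , there n

At⇒∈ : ∀ {T i j x} → At T i j x → x ∈ word T
At⇒∈ {_ ∷ rs} (here n)  = ∈-++⁺ʳ (word rs) (Nth⇒∈ n)
At⇒∈ {_ ∷ rs} (there a) = ∈-++⁺ˡ (At⇒∈ a)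

∈⇒At : ∀ {T x} → x ∈ word T → ∃ λ i → ∃ λ j → At T i j x
∈⇒At {r ∷ rs} x∈ with ∈-++⁻ (word rs) x∈
... | inj₁ x∈rs = let i , j , a = ∈⇒At x∈rs in suc i , j , there a
... | inj₂ x∈r  = let j , n = ∈⇒Nth x∈r in 0 , j , here n

At-zipLongʳ : ∀ {r C j i x} → At C j i x → length C ≤ length r → At (zipLong r C) j (suc i) x
At-zipLongʳ {_ ∷ _} (here n)  _       = here (there n)
At-zipLongʳ {_ ∷ _} (there a) (s≤s l) = there (At-zipLongʳ a l)

At-zipLongˡ : ∀ {r j x} C → Nth r j x → At (zipLong r C) j 0 x
At-zipLongˡ []      here      = here here
At-zipLongˡ (_ ∷ _) here      = here here
At-zipLongˡ []      (there n) = there (At-zipLongˡ [] n)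
At-zipLongˡ (_ ∷ C) (there n) = there (At-zipLongˡ C n)

At-transpose : ∀ {T i j x} → Part (shape T) → At T i j x → At (transpose T) j i x
At-transpose {_ ∷ rs} p (here n) = At-zipLongˡ (transpose rs) n
At-transpose {r ∷ rs} p@(part _ _ q) (there a) =
  At-zipLongʳ (At-transpose q a) (transpose-length≤ r rs p)

Nth-mono : ∀ {r j j' x y} → Inc r → Nth r j x → Nth r j' y → j ≤ j' → x ≤ y
Nth-mono _       here      here       _       = ≤-refl
Nth-mono (a ∷ i) here      (there n') _       = <⇒≤ (All.lookup a (Nth⇒∈ n'))
Nth-mono (_ ∷ i) (there n) (there n') (s≤s l) = Nth-mono i n n' l

Nth-strict : ∀ {r j j' x y} → Inc r → Nth r j x → Nth r j' y → j < j' → x < y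
Nth-strict (a ∷ i) here      (there n') _       = All.lookup a (Nth⇒∈ n')
Nth-strict (_ ∷ i) (there n) (there n') (s≤s l) = Nth-strict i n n' l

Below-Nth : ∀ {r s j y} → Below r s → Nth s j y → ∃ λ w → Nth r j w × w < y
Below-Nth (p ∷ bl) here      = _ , here , p
Below-Nth (p ∷ bl) (there n) = let w , m , l = Below-Nth bl n in w , there m , l

At-column : ∀ {r rs i j y} → IsTab (r ∷ rs) → At rs i j y → ∃ λ w → Nth r j w × w < y
At-column (row _ _ bl t) (here n)  = Below-Nth bl n
At-column (row _ _ bl t) (there a) =
  let w , n , w<y = At-column t a ; v , m , v<w = Below-Nth bl n in v , m , <-trans v<w w<y

At-< : ∀ {T i j i' j' x y} → IsTab T → At T i j x → At T i' j' y → i < i' → j ≤ j' → x < y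
At-< t@(row _ inc _ _) (here n) (there a) _ j≤j' =
  let w , m , w<y = At-column t a in ≤-<-trans (Nth-mono inc n m j≤j') w<y
At-< (row _ _ _ t) (there a) (there a') (s≤s l) j≤j' = At-< t a a' l j≤j'

At-≪ : ∀ {T i j i' j' x y} → IsTab T → At T i j x → At T i' j' y → i < i' → j < j' → suc x < y
At-≪ t@(row _ inc _ _) (here n) (there a) _ j<j' =
  let w , m , w<y = At-column t a in ≤-<-trans (Nth-strict inc n m j<j') w<y
At-≪ (row _ _ _ t) (there a) (there a') (s≤s l) j<j' = At-≪ t a a' l j<j'

At-row : ∀ {T i j j' x y} → IsTab T → At T i j x → At T i j' y → j ≤ j' → x ≤ y
At-row (row _ inc _ _) (here n)  (here n')  l = Nth-mono inc n n' l
At-row (row _ _ _ t)   (there a) (there a') l = At-row t a a' l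

At-mono : ∀ {T i j i' j' x y} → IsTab T → At T i j x → At T i' j' y → i ≤ i' → j ≤ j' → x ≤ y
At-mono t a a' i≤i' j≤j' with m≤n⇒m<n∨m≡n i≤i'
... | inj₁ i<i' = <⇒≤ (At-< t a a' i<i' j≤j')
... | inj₂ refl = At-row t a a' j≤j'

Before-rows : ∀ {U i j i' j' p q} → At U i j p → At U i' j' q → i' < i → Before p q (word U)
Before-rows {_ ∷ rs} (there a) (here n)   _       = Before-++ (At⇒∈ a) (Nth⇒∈ n)
Before-rows {_ ∷ rs} (there a) (there a') (s≤s l) = Before-++⁺ˡ _ (Before-rows a a' l)

Before-Nth : ∀ {r j j' p q} → Nth r j p → Nth r j' q → j < j' → Before p q r
Before-Nth here      (there n') _       = here (Nth⇒∈ n')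
Before-Nth (there n) (there n') (s≤s l) = there (Before-Nth n n' l)

Before-row : ∀ {U i j j' p q} → At U i j p → At U i j' q → j < j' → Before p q (word U)
Before-row {_ ∷ rs} (here n)  (here n')  l = Before-++⁺ʳ (word rs) (Before-Nth n n' l)
Before-row {_ ∷ rs} (there a) (there a') l = Before-++⁺ˡ _ (Before-row a a' l)

-- An entry strictly above and strictly left of another differs from it by at least 2, because
-- of the entry in the corner between them: hence suc k lies weakly left of k if it lies below k.
descent⇒Before : ∀ {T i j i' j' k} → IsTab T → At T i j k → At T i' j' (suc k) → i < i' →
  Before k (suc k) (word (transpose T))
descent⇒Before {i = i} {j} {i'} {j'} t a a' i<i' with <-cmp j' j
... | tri< j'<j _ _ = Before-rows (At-transpose (IsTab⇒Part t) a) (At-transpose (IsTab⇒Part t) a') j'<j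
... | tri≈ _ refl _ = Before-row (At-transpose (IsTab⇒Part t) a) (At-transpose (IsTab⇒Part t) a') i<i'
... | tri> _ _ j<j' = ⊥-elim (<-irrefl refl (At-≪ t a a' i<i' j<j'))

-- Were `suc k` weakly above and weakly left of `k`, it could not be larger. So it lies in a column
-- further right, which `word (transpose T)` reads earlier.
ascent⇒Before : ∀ {T i j i' j' k} → IsTab T → At T i j k → At T i' j' (suc k) → i' ≤ i →
  Before (suc k) k (word (transpose T))
ascent⇒Before {i = i} {j} {i'} {j'} t a a' i'≤i with j' ≤? j
... | yes j'≤j = ⊥-elim (<-irrefl refl (At-mono t a' a i'≤i j'≤j))
... | no j'≰j  =
  Before-rows (At-transpose (IsTab⇒Part t) a') (At-transpose (IsTab⇒Part t) a) (≰⇒> j'≰j)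

At-addEntry : ∀ i k T → ∃ λ j → At (addEntry i k T) i j k
At-addEntry zero    k []      = 0 , here here
At-addEntry zero    k (r ∷ T) = let j , n = ∈⇒Nth (∈-++⁺ʳ r (here refl)) in j , here n
At-addEntry (suc i) k []      = let j , a = At-addEntry i k [] in j , there a
At-addEntry (suc i) k (r ∷ T) = let j , a = At-addEntry i k T in j , there a

addEntry-At : ∀ i k {T i' j x} → At T i' j x → At (addEntry i k T) i' j x
addEntry-At zero    k (here n)  = here (Nth-∷ʳ n)
  where
  Nth-∷ʳ : ∀ {r j x} → Nth r j x → Nth (r ++ [ k ]) j x
  Nth-∷ʳ here      = here
  Nth-∷ʳ (there n) = there (Nth-∷ʳ n)
addEntry-At zero    k (there a) = there a
addEntry-At (suc i) k (here n)  = here n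
addEntry-At (suc i) k (there a) = there (addEntry-At i k a)

rowOf⇒At : ∀ {x i} T → rowOf x T ≡ just i → ∃ λ j → At T i j x
-- Induction on the first row avoids the membership test local to `rowOf`: once `x ≡ᵇ y` is false,
-- the value at `(y ∷ r) ∷ rs` computes to the value at `r ∷ rs`.
rowOf-∷⇒At : ∀ {x i} r rs → rowOf x (r ∷ rs) ≡ just i → ∃ λ j → At (r ∷ rs) i j x
rowOf⇒At (r ∷ rs) e = rowOf-∷⇒At r rs e
rowOf-∷⇒At {x} [] rs e with rowOf x rs in eq
rowOf-∷⇒At {x} [] rs refl | just _ = let j , a = rowOf⇒At rs eq in j , there a
rowOf-∷⇒At {x} (y ∷ r) rs e with x ≡ᵇ y in eq
rowOf-∷⇒At {x} (y ∷ r) rs refl | true with ≡ᵇ⇒≡ x y (subst T (sym eq) tt)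
... | refl = 0 , here here
rowOf-∷⇒At {x} (y ∷ r) rs e | false with rowOf-∷⇒At r rs e
... | j , here n  = suc j , here (there n)
... | j , there a = j , there a

∈⇒rowOf : ∀ {x} T → x ∈ word T → ∃ λ i → rowOf x T ≡ just i
∈-∷⇒rowOf : ∀ {x} r rs → x ∈ word rs ++ r → ∃ λ i → rowOf x (r ∷ rs) ≡ just i
∈⇒rowOf (r ∷ rs) x∈ = ∈-∷⇒rowOf r rs x∈
∈-∷⇒rowOf {x} [] rs x∈ with ∈⇒rowOf {x} rs (subst (x ∈_) (++-identityʳ _) x∈)
... | i , e rewrite e = suc i , refl
∈-∷⇒rowOf {x} (y ∷ r) rs x∈ with x ≡ᵇ y in eq
... | true = 0 , refl
... | false with ∈-++⁻ (word rs) x∈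
...   | inj₁ x∈rs        = ∈-∷⇒rowOf r rs (∈-++⁺ˡ x∈rs)
...   | inj₂ (there x∈r) = ∈-∷⇒rowOf r rs (∈-++⁺ʳ (word rs) x∈r)
...   | inj₂ (here refl) = ⊥-elim (subst T eq (≡⇒≡ᵇ x x refl))

-- Agreement of `rowDelete` with its graph, and existence of deletions

lastOr-∷ʳ : ∀ d r y → lastOr d (r ++ [ y ]) ≡ y
lastOr-∷ʳ d []      y = refl
lastOr-∷ʳ d (x ∷ r) y = lastOr-∷ʳ x r y

init-∷ʳ : ∀ r y → init (r ++ [ y ]) ≡ r
init-∷ʳ []          y = refl
init-∷ʳ (x ∷ [])    y = refl
init-∷ʳ (x ∷ z ∷ r) y = cong (x ∷_) (init-∷ʳ (z ∷ r) y)

unbumpRows-∷ʳ : ∀ {y o z r r'} A {A'} → unbumpRows y A ≡ (A' , o) → unbump o r ≡ (r' , z) →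
  unbumpRows y (A ++ [ r ]) ≡ (A' ++ [ r' ] , z)
unbumpRows-∷ʳ []      refl e rewrite e = refl
unbumpRows-∷ʳ {y} (s ∷ A) refl e' =
  cong (λ (B , z) → proj₁ (unbump y s) ∷ B , z) (unbumpRows-∷ʳ A refl e')

Del⇒rowDelete : ∀ {j U U' x} → Del j U U' x → rowDelete j U ≡ (U' , x)
Del⇒rowDelete {j} {U} d with path d
  where
  -- The intermediate values of `rowDelete`. A row added on top becomes the last one of the reversed
  -- prefix, so each `down` extends the run of `unbumpRows` at its end.
  path : ∀ {j U U' x} → Del j U U' x → ∃ λ r → ∃ λ A → nth j U ≡ just r ×
    unbumpRows (lastOr 0 r) (reverse (take j U)) ≡ (A , x) ×
    reverse A ++ nonEmptyRow (init r) ++ drop (suc j) U ≡ U'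
  path top₁ = _ , [] , refl , refl , refl
  path (top₂ {r₀ = x ∷ r₀} {y} {rs} refl _ _) = _ , [] , refl ,
    cong ([] ,_) (lastOr-∷ʳ x r₀ y) ,
    cong (λ r → nonEmptyRow r ++ rs) (init-∷ʳ (x ∷ r₀) y)
  path (down {j} {r} {r'} {rs} d b) with path d
  ... | q , A , e₁ , e₂ , e₃ = q , A ++ [ r' ] , e₁ ,
    trans (cong (unbumpRows (lastOr 0 q)) (unfold-reverse r (take j rs)))
          (unbumpRows-∷ʳ (reverse (take j rs)) e₂ (Unbump⇒unbump b)) ,
    trans (cong (_++ _) (reverse-++ A [ r' ])) (cong (r' ∷_) e₃)
... | r , A , e₁ , e₂ , e₃ rewrite e₁ | e₂ | e₃ = refl

-- The letter coming up leaves the first row of `rs`, where the entry of `r` above it is smaller. So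
-- `r` has an entry for it to replace, and distinctness excludes a tie.
Del-exists : ∀ j {U σ} → IsTab U → Unique (word U) → shape U ≡ addBox j σ → Part σ →
  ∃ λ U' → ∃ λ x → Del j U U' x × shape U' ≡ σ
Del-exists zero    {σ = []}    [] _ () _
Del-exists zero    {σ = _ ∷ _} [] _ () _
Del-exists (suc j) {σ = []}    [] _ () _
Del-exists (suc j) {σ = _ ∷ _} [] _ () _
Del-exists zero {(y ∷ []) ∷ []} {[]} (row _ _ _ _) _ _ _ = _ , _ , top₁ , refl
Del-exists zero {r ∷ rs} {s ∷ σ} (row _ _ _ _) _ e (part s>0 h _) with initLast r
... | []      = ⊥-elim (0≢1+n (∷-injectiveˡ e))
... | r₀ ∷ʳ′ y = _ , _ , top₂ refl (subst (0 <_) (sym len) s>0)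
      (subst₂ _≤_ (trans (cong hd (sym (∷-injectiveʳ e))) (hd-shape rs)) (sym len) h) ,
      cong₂ _∷_ len (∷-injectiveʳ e)
  where
  len : length r₀ ≡ s
  len = suc-injective (trans (trans (+-comm 1 (length r₀)) (sym (length-++ r₀))) (∷-injectiveˡ e))
Del-exists (suc j) {r ∷ rs} {[]} (row ne _ _ _) _ e _ = ⊥-elim (<-irrefl (sym (∷-injectiveˡ e)) ne)
Del-exists (suc j) {r ∷ rs} {s ∷ σ} (row _ i bl t) u e (part _ _ p)
  with Del-exists j t (Unique-++⁻ˡ (word rs) u) (∷-injectiveʳ e) p
... | rs' , y , d , e' with unbumpable r i bl y∉r
  where
  y∉r : y ∉ r
  y∉r y∈r = Unique-++⇒disjoint (word rs) u (firstRow⊆word rs (Drop-∈ (Del⇒Drop d))) y∈r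
    where
    firstRow⊆word : ∀ rs {y} → y ∈ firstRow rs → y ∈ word rs
    firstRow⊆word (r ∷ rs) y∈ = ∈-++⁺ʳ (word rs) y∈
  unbumpable : ∀ r → Inc r → Below r (firstRow rs) → y ∉ r → ∃ λ r' → ∃ λ z → Unbump y r r' z
  unbumpable r i bl y∉ with r | i | y∉ | Below-∈ bl (Drop-∈ (Del⇒Drop d))
  ... | z ∷ zs | a ∷ i | y∉' | w , here refl , w<y =
    Unbump-exists w<y (a ∷ i) (All.tabulate λ { v∈ refl → y∉' (there v∈) })
  ... | z ∷ zs | a ∷ i | y∉' | w , there w∈ , w<y =
    Unbump-exists (<-trans (All.lookup a w∈) w<y) (a ∷ i) (All.tabulate λ { v∈ refl → y∉' (there v∈) })
... | r' , z , b = r' ∷ rs' , z , down d b , cong₂ _∷_ (trans (Unbump-length b) (∷-injectiveˡ e)) e'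

-- Steps of an oscillating tableau

data StepRel (μ ν : Partition) : Step → Set where
  expand   : ∀ {i} → ν ≡ addBox i μ → StepRel μ ν (expansion i)
  contract : ∀ {i} → μ ≡ addBox i ν → StepRel μ ν (contraction i)

sum-addBox : ∀ i μ → sum (addBox i μ) ≡ suc (sum μ)
sum-addBox zero    []      = refl
sum-addBox zero    (x ∷ μ) = refl
sum-addBox (suc i) []      = sum-addBox i []
sum-addBox (suc i) (x ∷ μ) = trans (cong (x +_) (sum-addBox i μ)) (+-suc x (sum μ))

diffRow-addBox : ∀ i μ → Part (addBox i μ) → diffRow μ (addBox i μ) ≡ i
diffRow-addBox zero    []      _ = refl
diffRow-addBox zero    (x ∷ μ) _ with x ≡ᵇ suc x in eq
... | false = refl
... | true  = ⊥-elim (1+n≢n (sym (≡ᵇ⇒≡ x (suc x) (subst T (sym eq) tt))))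
diffRow-addBox (suc i) []      (part () _ _)
diffRow-addBox (suc i) (x ∷ μ) (part _ _ p) with x ≡ᵇ x in eq
... | true  = cong suc (diffRow-addBox i μ p)
... | false = ⊥-elim (subst T eq (≡⇒≡ᵇ x x refl))

stepOf-rel : ∀ {μ ν} → DiffOneBox μ ν → Part μ → Part ν → StepRel μ ν (stepOf μ ν)
stepOf-rel {μ} (inj₁ (i , refl)) _ q
  rewrite sum-addBox i μ with sum μ <ᵇ suc (sum μ) | <ᵇ-reflects-< (sum μ) (suc (sum μ))
... | true  | _       = subst (λ j → StepRel μ (addBox i μ) (expansion j)) (sym (diffRow-addBox i μ q)) (expand refl)
... | false | ofⁿ n≮n = ⊥-elim (n≮n ≤-refl)
stepOf-rel {ν = ν} (inj₂ (i , refl)) p _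
  rewrite sum-addBox i ν with suc (sum ν) <ᵇ sum ν | <ᵇ-reflects-< (suc (sum ν)) (sum ν)
... | false | _      = subst (λ j → StepRel (addBox i ν) ν (contraction j)) (sym (diffRow-addBox i ν p)) (contract refl)
... | true  | ofʸ lt = ⊥-elim (<-asym lt ≤-refl)

-- The involution of Sun₁ and its word

Involution : Set
Involution = List (ℕ × ℕ)

invApply-fst : ∀ x k ι → invApply x ((x , k) ∷ ι) ≡ just k
invApply-fst x k ι with x ≡ᵇ x in eq
... | true  = refl
... | false = ⊥-elim (subst T eq (≡⇒≡ᵇ x x refl))

invApply-snd : ∀ x k ι → x ≢ k → invApply k ((x , k) ∷ ι) ≡ just x
invApply-snd x k ι x≢k with k ≡ᵇ x in eq
... | true = ⊥-elim (x≢k (sym (≡ᵇ⇒≡ k x (subst T (sym eq) tt))))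
... | false with k ≡ᵇ k in eq'
...   | true  = refl
...   | false = ⊥-elim (subst T eq' (≡⇒≡ᵇ k k refl))

invApply-other : ∀ {a} x k ι → a ≢ x → a ≢ k → invApply a ((x , k) ∷ ι) ≡ invApply a ι
invApply-other {a} x k ι a≢x a≢k with a ≡ᵇ x in eq
... | true = ⊥-elim (a≢x (≡ᵇ⇒≡ a x (subst T (sym eq) tt)))
... | false with a ≡ᵇ k in eq'
...   | true  = ⊥-elim (a≢k (≡ᵇ⇒≡ a k (subst T (sym eq') tt)))
...   | false = refl

invWordFrom-just : ∀ {a b ι} m → invApply a ι ≡ just b →
  invWordFrom a (suc m) ι ≡ b ∷ invWordFrom (suc a) m ι
invWordFrom-just m e rewrite e = refl

invWordFrom-nothing : ∀ {a ι} m → invApply a ι ≡ nothing →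
  invWordFrom a (suc m) ι ≡ invWordFrom (suc a) m ι
invWordFrom-nothing m e rewrite e = refl

invWordFrom-++ : ∀ a m l ι → invWordFrom a (m + l) ι ≡ invWordFrom a m ι ++ invWordFrom (a + m) l ι
invWordFrom-++ a zero    l ι = cong (λ b → invWordFrom b l ι) (sym (+-identityʳ a))
invWordFrom-++ a (suc m) l ι with invApply a ι | invWordFrom-++ (suc a) m l ι
... | nothing | e = trans e (cong (λ b → invWordFrom (suc a) m ι ++ invWordFrom b l ι) (sym (+-suc a m)))
... | just b  | e = cong (b ∷_)
  (trans e (cong (λ b → invWordFrom (suc a) m ι ++ invWordFrom b l ι) (sym (+-suc a m))))

invWordFrom-cong : ∀ a m ι ι' → (∀ b → a ≤ b → b < a + m → invApply b ι ≡ invApply b ι') →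
  invWordFrom a m ι ≡ invWordFrom a m ι'
invWordFrom-cong a zero    ι ι' eq = refl
invWordFrom-cong a (suc m) ι ι' eq
  with invApply a ι | invApply a ι' | eq a ≤-refl (m<m+n a (s≤s z≤n))
     | invWordFrom-cong (suc a) m ι ι' (λ b a<b b< → eq b (<⇒≤ a<b) (subst (b <_) (sym (+-suc a m)) b<))
... | nothing | _ | refl | e = e
... | just c  | _ | refl | e = cong (c ∷_) e

invWordFrom-empty : ∀ a m ι → (∀ b → a ≤ b → invApply b ι ≡ nothing) → invWordFrom a m ι ≡ []
invWordFrom-empty a zero    ι eq = refl
invWordFrom-empty a (suc m) ι eq =
  trans (invWordFrom-nothing m (eq a ≤-refl)) (invWordFrom-empty (suc a) m ι (λ b a<b → eq b (<⇒≤ a<b)))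

invWordFrom-∈ : ∀ {a m ι c p} → invApply c ι ≡ just p → a ≤ c → c < a + m → p ∈ invWordFrom a m ι
invWordFrom-∈ {a} {zero} e a≤c c< = ⊥-elim (<-irrefl refl (≤-<-trans a≤c (subst (_ <_) (+-identityʳ a) c<)))
invWordFrom-∈ {a} {suc m} {ι} {c} e a≤c c< with m≤n⇒m<n∨m≡n a≤c
... | inj₂ refl = subst (_ ∈_) (sym (invWordFrom-just {ι = ι} m e)) (here refl)
... | inj₁ a<c with invApply a ι | invWordFrom-∈ {suc a} {m} e a<c (subst (c <_) (+-suc a m) c<)
...   | nothing | p∈ = p∈
...   | just _  | p∈ = there p∈

invWordFrom-Before : ∀ {a m ι c d p q} → invApply c ι ≡ just p → invApply d ι ≡ just q →
  a ≤ c → c < d → d < a + m → Before p q (invWordFrom a m ι)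
invWordFrom-Before {a} {zero} e e' a≤c c<d d< =
  ⊥-elim (<-irrefl refl (≤-<-trans (≤-trans a≤c (<⇒≤ c<d)) (subst (_ <_) (+-identityʳ a) d<)))
invWordFrom-Before {a} {suc m} {ι} {c} {d} e e' a≤c c<d d< with m≤n⇒m<n∨m≡n a≤c
... | inj₂ refl = subst (Before _ _) (sym (invWordFrom-just {ι = ι} m e))
                    (here (invWordFrom-∈ {ι = ι} e' c<d (subst (d <_) (+-suc a m) d<)))
... | inj₁ a<c with invApply a ι | invWordFrom-Before {suc a} {m} e e' a<c c<d (subst (d <_) (+-suc a m) d<)
...   | nothing | b = b
...   | just _  | b = there b

-- Pairing `x` with `n + 1` puts the letter `n + 1` at index `x`, and the letter `x` at index
-- `n + 1`, which is beyond all indices in use. So `x` comes last, and `u`, `v` are the letters at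
-- the indices below and above `x`.
invWord-extend : ∀ {R n x ι} → 1 ≤ x → x ≤ n → suc n ≤ R →
  invApply x ι ≡ nothing → (∀ c → n < c → invApply c ι ≡ nothing) →
  ∃ λ u → ∃ λ v → invWordFrom 1 R ι ≡ u ++ v ×
                  invWordFrom 1 R ((x , suc n) ∷ ι) ≡ u ++ suc n ∷ v ++ [ x ]
invWord-extend {ι = ι} (s≤s {n = p} z≤n) x≤n n<R x∉ι big with m≤n⇒∃[o]m+o≡n x≤n | m≤n⇒∃[o]m+o≡n n<R
... | q , refl | s , refl = u , v , eq , eq'
  where
  x = suc p
  k = suc (x + q)
  ι' = (x , k) ∷ ι
  u = invWordFrom 1 p ι
  v = invWordFrom (suc x) q ι
  x≢k : x ≢ k
  x≢k e = <-irrefl e (s≤s (m≤m+n x q))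
  -- The range 1 to `R` consists of `p` indices below `x`, then `x`, then `q` indices between `x`
  -- and `k`, then `k` and `s` further ones.
  R≡ : k + s ≡ p + suc (q + suc s)
  R≡ = begin
    suc (suc (p + q)) + s   ≡⟨ sym (+-suc (suc (p + q)) s) ⟩
    suc (p + q) + suc s     ≡⟨ cong (_+ suc s) (sym (+-suc p q)) ⟩
    p + suc q + suc s       ≡⟨ +-assoc p (suc q) (suc s) ⟩
    p + suc (q + suc s)     ∎
    where open ≡-Reasoning
  split : ∀ κ → invWordFrom 1 (k + s) κ ≡ invWordFrom 1 p κ ++ invWordFrom x (suc (q + suc s)) κ
  split κ = trans (cong (λ m → invWordFrom 1 m κ) R≡) (invWordFrom-++ 1 p (suc (q + suc s)) κ)
  eq : invWordFrom 1 (k + s) ι ≡ u ++ v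
  eq = trans (split ι) (cong (u ++_) (begin
    invWordFrom x (suc (q + suc s)) ι          ≡⟨ invWordFrom-nothing (q + suc s) x∉ι ⟩
    invWordFrom (suc x) (q + suc s) ι          ≡⟨ invWordFrom-++ (suc x) q (suc s) ι ⟩
    v ++ invWordFrom k (suc s) ι               ≡⟨ cong (v ++_) (invWordFrom-empty k (suc s) ι big) ⟩
    v ++ []                                    ≡⟨ ++-identityʳ v ⟩
    v                                          ∎))
    where open ≡-Reasoning
  eq' : invWordFrom 1 (k + s) ι' ≡ u ++ k ∷ v ++ [ x ]
  eq' = trans (split ι') (cong₂ _++_
    (invWordFrom-cong 1 p ι' ι λ b _ b<x → invApply-other x k ι (<⇒≢ b<x)
      (<⇒≢ (<-trans b<x (s≤s (m≤m+n x q)))))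
    (begin
    invWordFrom x (suc (q + suc s)) ι'          ≡⟨ invWordFrom-just (q + suc s) (invApply-fst x k ι) ⟩
    k ∷ invWordFrom (suc x) (q + suc s) ι'      ≡⟨ cong (k ∷_) (invWordFrom-++ (suc x) q (suc s) ι') ⟩
    k ∷ invWordFrom (suc x) q ι' ++ invWordFrom k (suc s) ι'
      ≡⟨ cong₂ (λ v w → k ∷ v ++ w)
           (invWordFrom-cong (suc x) q ι' ι λ b x<b b<k → invApply-other x k ι (≢-sym (<⇒≢ x<b)) (<⇒≢ b<k))
           (invWordFrom-just s (invApply-snd x k ι x≢k)) ⟩
    k ∷ v ++ x ∷ invWordFrom (suc k) s ι'
      ≡⟨ cong (λ w → k ∷ v ++ x ∷ w) (invWordFrom-empty (suc k) s ι' λ b k<b →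
           trans (invApply-other x k ι (≢-sym (<⇒≢ (<-trans (s≤s (m≤m+n x q)) k<b))) (≢-sym (<⇒≢ k<b)))
                 (big b (<-trans ≤-refl k<b))) ⟩
    k ∷ v ++ [ x ]                              ∎))
    where open ≡-Reasoning

-- The invariant along Sun₁

-- The word ι(a₁)…ι(a_m) followed by the column reading word of T; it is related by ~ to the
-- column reading word of Q.
sunWord : ℕ → Involution → Tableau → Word
sunWord R ι T = invWordFrom 1 R ι ++ reverse (word (transpose T))

-- Here `s` is step `n` and `t` is step `n + 1`. Deciding the descent together with the order of the
-- letters serves both directions of the equivalence.
Outcome : ℕ → Step → Step → Word → Set
Outcome n s t w = (DescentPair s t × Before (suc n) n w) ⊎ (¬ DescentPair s t × Before n (suc n) w)

-- After `n` of `R` steps. The word of `ι` is always scanned up to `R`, so that its range stays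
-- fixed; by `bounded` the indices beyond `n` contribute nothing. By `perm` each of 1 to `n` occurs
-- exactly once, either in that word or in `T`.
record State (R n : ℕ) (μ : Partition) (ι : Involution) (T : Tableau) : Set where
  field
    isTab   : IsTab T
    shape≡  : shape T ≡ μ
    bounded : ∀ {a b} → invApply a ι ≡ just b → 1 ≤ a × a ≤ n
    symm    : ∀ {a b} → invApply a ι ≡ just b → invApply b ι ≡ just a
    perm    : sunWord R ι T ↭ applyDownFrom suc n

-- What the next step has to know about step `n`: the place of the entry `n`, or else the deletion
-- on transposes that ejected the partner of `n`. The latter starts in the column `rowLen i μ` of
-- the deleted box.
data LastStep (n : ℕ) (μ : Partition) (ι : Involution) (T : Tableau) : Step → Set where
  expanded   : ∀ {i j} → At T i j n → LastStep n μ ι T (expansion i)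
  contracted : ∀ {i x U₀} → invApply x ι ≡ just n → IsTab U₀ →
               Del (rowLen i μ) U₀ (transpose T) x → LastStep n μ ι T (contraction i)

record Insertion (k : ℕ) (w w' : Word) : Set where
  constructor insertion
  field
    before after : Word
    old : w ≡ before ++ after
    new : before ++ k ∷ after ~ w'

Insertion-Before : ∀ {k w w' p q} → Insertion k w w' → Consecutive p q → Before p q w → Before p q w'
Insertion-Before {k} (insertion a b refl r) c bef = Before-resp-~ c r (Before-insert a k bef)

Insertion-↭ : ∀ {k w w' v} → Insertion k w w' → w ↭ v → w' ↭ k ∷ v
Insertion-↭ {k} (insertion a b refl r) p =
  ↭-trans (↭-sym (~⇒↭ r)) (↭-trans (shift k a b) (↭-prep k p))

-- `inserted` preserves the orders of consecutive letters fixed by earlier steps, and `outcome`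
-- fixes the order of `n` and `n + 1`.
record Next (R n : ℕ) (ν : Partition) (ι : Involution) (T : Tableau) (t : Step) : Set where
  field
    {ι'} : Involution
    {T'} : Tableau
    sun₁≡    : ∀ ss → sun₁ (suc n) (t ∷ ss) ι T ≡ sun₁ (suc (suc n)) ss ι' T'
    state    : State R (suc n) ν ι' T'
    lastStep : LastStep (suc n) ν ι' T' t
    inserted : Insertion (suc n) (sunWord R ι T) (sunWord R ι' T')
    outcome  : ∀ {μ s} → Part μ → StepRel μ ν t → LastStep n μ ι T s →
               Outcome n s t (sunWord R ι' T')

∈-applyDownFrom-suc⁻ : ∀ {x} n → x ∈ applyDownFrom suc n → 1 ≤ x × x ≤ n
∈-applyDownFrom-suc⁻ (suc n) (here refl) = s≤s z≤n , ≤-refl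
∈-applyDownFrom-suc⁻ (suc n) (there x∈)  =
  let l , u = ∈-applyDownFrom-suc⁻ n x∈ in l , m≤n⇒m≤1+n u

Unique-applyDownFrom-suc : ∀ n → Unique (applyDownFrom suc n)
Unique-applyDownFrom-suc n = Unique.applyDownFrom⁺₁ suc n
  λ j<i _ e → <-irrefl (sym (suc-injective e)) j<i

∈-transpose : ∀ {T x} → Part (shape T) → x ∈ word T → x ∈ word (transpose T)
∈-transpose p x∈ = let i , j , a = ∈⇒At x∈ in At⇒∈ (At-transpose p a)

module _ {R n μ ι T} (st : State R n μ ι T) where
  open State st

  private
    Tᵗ = transpose T

  sunWord-unique : Unique (sunWord R ι T)
  sunWord-unique = Unique-resp-↭ (↭-sym perm) (Unique-applyDownFrom-suc n)

  sunWord-range : ∀ {x} → x ∈ sunWord R ι T → 1 ≤ x × x ≤ n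
  sunWord-range x∈ = ∈-applyDownFrom-suc⁻ n (∈-resp-↭ perm x∈)

  entry∈sunWord : ∀ {x} → x ∈ word Tᵗ → x ∈ sunWord R ι T
  entry∈sunWord x∈ = ∈-++⁺ʳ (invWordFrom 1 R ι) (∈-reverse⁺ x∈)

  -- A partner `b` of `x` would make `x` the letter at index `b` of the word of `ι`, so that `x`
  -- would occur twice in `sunWord`.
  unpaired-entry : ∀ {x} → n ≤ R → x ∈ word Tᵗ → invApply x ι ≡ nothing
  unpaired-entry {x} n≤R x∈ with invApply x ι in e
  ... | nothing = refl
  ... | just b  = ⊥-elim (Unique-++⇒disjoint (invWordFrom 1 R ι) sunWord-unique x∈ι (∈-reverse⁺ x∈))
    where
    x∈ι : x ∈ invWordFrom 1 R ι
    x∈ι = let 1≤b , b≤n = bounded (symm e) in invWordFrom-∈ (symm e) 1≤b (s≤s (≤-trans b≤n n≤R))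

  unpaired-later : ∀ c → n < c → invApply c ι ≡ nothing
  unpaired-later c n<c with invApply c ι in e
  ... | nothing = refl
  ... | just b  = ⊥-elim (<-irrefl refl (<-≤-trans n<c (proj₂ (bounded e))))

  invWord-∈ : ∀ {a b} → n ≤ R → invApply a ι ≡ just b → b ∈ invWordFrom 1 R ι
  invWord-∈ n≤R e = let 1≤a , a≤n = bounded e in invWordFrom-∈ e 1≤a (s≤s (≤-trans a≤n n≤R))

  next-expansion : ∀ {i} → suc n ≤ R → Part (addBox i μ) → Next R n (addBox i μ) ι T (expansion i)
  next-expansion {i} n<R pν = record
    { sun₁≡    = λ _ → refl
    ; state    = record
      { isTab   = tab'
      ; shape≡  = trans (shape-addEntry i k T) (cong (addBox i) shape≡)
      ; bounded = λ e → let l , u = bounded e in l , m≤n⇒m≤1+n u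
      ; symm    = symm
      ; perm    = Insertion-↭ ins perm }
    ; lastStep = expanded (proj₂ (At-addEntry i k T))
    ; inserted = ins
    ; outcome  = λ _ _ → out }
    where
    k  = suc n
    T' = addEntry i k T
    w  = invWordFrom 1 R ι
    pT = IsTab⇒Part isTab
    pν' : Part (addBox i (shape T))
    pν' = subst (λ μ → Part (addBox i μ)) (sym shape≡) pν
    tab' : IsTab T'
    tab' = addEntry-IsTab i isTab
      (All.tabulate λ x∈ → s≤s (proj₂ (sunWord-range (entry∈sunWord (∈-transpose pT x∈))))) pν'
    ins : Insertion k (sunWord R ι T) (sunWord R ι T')
    ins with word-addEntry (rowLen i (shape T)) k Tᵗ
    -- Reversal exchanges the two halves of the word around the new letter.
    ... | u , v , e , e' = insertion (w ++ reverse v) (reverse u)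
      (trans (cong (λ z → w ++ reverse z) e)
      (trans (cong (w ++_) (reverse-++ u v)) (sym (++-assoc w _ _))))
      (~-reflexive (trans (++-assoc w (reverse v) (k ∷ reverse u)) (cong (w ++_) (sym
        (trans (cong reverse (trans (cong word (transpose-addEntry i k T pT pν')) e'))
        (trans (reverse-++ u (k ∷ v))
        (trans (cong (_++ reverse u) (unfold-reverse k v)) (++-assoc (reverse v) [ k ] (reverse u)))))))))
    out : ∀ {μ s} → LastStep n μ ι T s → Outcome n s (expansion i) (sunWord R ι T')
    out (expanded {i'} a) with i' <? i
    ... | yes i'<i = inj₁ (exp-exp i'<i , Before-++⁺ʳ w (Before-reverse
      (descent⇒Before tab' (addEntry-At i k a) (proj₂ (At-addEntry i k T)) i'<i)))
    ... | no i'≮i  = inj₂ ((λ { (exp-exp i'<i) → i'≮i i'<i }) , Before-++⁺ʳ w (Before-reverse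
      (ascent⇒Before tab' (addEntry-At i k a) (proj₂ (At-addEntry i k T)) (≮⇒≥ i'≮i))))
    -- After a contraction `n` belongs to the word of `ι`, whereas `n + 1` is an entry of the
    -- tableau and so comes later.
    out (contracted e _ _) = inj₂ ((λ ()) ,
      Before-++ (invWord-∈ (<⇒≤ n<R) e)
        (∈-reverse⁺ (∈-transpose (IsTab⇒Part tab') (At⇒∈ (proj₂ (At-addEntry i k T))))))

-- Conjugate shapes and the contraction step

hd-zipLong : ∀ r C → hd (shape (zipLong r C)) ≤ suc (hd (shape C))
hd-zipLong []      C       = n≤1+n _
hd-zipLong (_ ∷ _) []      = ≤-refl
hd-zipLong (_ ∷ _) (_ ∷ _) = ≤-refl

zipLong-Part : ∀ r C → length C ≤ length r → Part (shape C) → Part (shape (zipLong r C))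
zipLong-Part []      []      _       _            = []
zipLong-Part (x ∷ r) []      _       _            = part (s≤s z≤n) (hd-zipLong r []) (zipLong-Part r [] z≤n [])
zipLong-Part (x ∷ r) (c ∷ C) (s≤s l) (part _ h p) =
  part (s≤s z≤n) (≤-trans (hd-zipLong r C) (s≤s h)) (zipLong-Part r C l p)

transpose-Part : ∀ T → Part (shape T) → Part (shape (transpose T))
transpose-Part []      _ = []
transpose-Part (r ∷ T) p@(part _ _ q) =
  zipLong-Part r (transpose T) (transpose-length≤ r T p) (transpose-Part T q)

zeros : Partition → Tableau
zeros = map (λ m → replicate m 0)

shape-zeros : ∀ μ → shape (zeros μ) ≡ μ
shape-zeros []      = refl
shape-zeros (m ∷ μ) = cong₂ _∷_ (length-replicate m) (shape-zeros μ)

nth-shape : ∀ i T → 0 < rowLen i (shape T) → ∃ λ r → nth i T ≡ just r × length r ≡ rowLen i (shape T)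
nth-shape zero    (r ∷ T) _ = r , refl , refl
nth-shape (suc i) (r ∷ T) l = nth-shape i T l

-- The conjugate of a shape is only available as the shape of a transpose, so the shape of the
-- transpose of T is computed from the filling of ν by zeros.
colDelete-Del : ∀ i {T ν} → IsTab T → Unique (word (transpose T)) → shape T ≡ addBox i ν → Part ν →
  ∃ λ T' → ∃ λ x → colDelete i T ≡ (T' , x) × IsTab T' × shape T' ≡ ν ×
    Del (rowLen i ν) (transpose T) (transpose T') x
colDelete-Del i {T} {ν} t u e p
  with Del-exists (rowLen i ν) (transpose-IsTab t) u
         (begin
           shape (transpose T)                                  ≡⟨ transpose-shape T (addEntry i 0 (zeros ν)) shape≡ ⟩
           shape (transpose (addEntry i 0 (zeros ν)))           ≡⟨ cong shape (transpose-addEntry i 0 (zeros ν) pZ pZ') ⟩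
           shape (addEntry (rowLen i (shape (zeros ν))) 0 (transpose (zeros ν)))
             ≡⟨ shape-addEntry (rowLen i (shape (zeros ν))) 0 (transpose (zeros ν)) ⟩
           addBox (rowLen i (shape (zeros ν))) (shape (transpose (zeros ν)))
             ≡⟨ cong (λ σ → addBox (rowLen i σ) (shape (transpose (zeros ν)))) (shape-zeros ν) ⟩
           addBox (rowLen i ν) (shape (transpose (zeros ν)))    ∎)
         (transpose-Part (zeros ν) pZ)
  where
  open ≡-Reasoning
  pZ : Part (shape (zeros ν))
  pZ = subst Part (sym (shape-zeros ν)) p
  pZ' : Part (addBox i (shape (zeros ν)))
  pZ' = subst (λ σ → Part (addBox i σ)) (sym (shape-zeros ν)) (subst Part e (IsTab⇒Part t))
  shape≡ : shape T ≡ shape (addEntry i 0 (zeros ν))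
  shape≡ = trans e (trans (cong (addBox i) (sym (shape-zeros ν))) (sym (shape-addEntry i 0 (zeros ν))))
... | U' , x , d , e' = transpose U' , x , colDelete≡ , transpose-IsTab tU' , shapeT' ,
        subst (λ V → Del (rowLen i ν) (transpose T) V x) (sym (transpose-involutive U' (IsTab⇒Part tU'))) d
  where
  tU' : IsTab U'
  tU' = Del-IsTab d (transpose-IsTab t)
  shapeT' : shape (transpose U') ≡ ν
  shapeT' = trans (transpose-shape U' (transpose (zeros ν)) e')
    (trans (cong shape (transpose-involutive (zeros ν) (subst Part (sym (shape-zeros ν)) p))) (shape-zeros ν))
  rowLen≡ : rowLen i (shape T) ≡ suc (rowLen i ν)
  rowLen≡ = trans (cong (rowLen i) e) (rowLen-addBox i ν)
  colDelete≡ : colDelete i T ≡ (transpose U' , x)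
  colDelete≡ with nth-shape i T (subst (0 <_) (sym rowLen≡) (s≤s z≤n))
  ... | r , e₁ , e₂ rewrite e₁ | trans e₂ rowLen≡ | Del⇒rowDelete d = refl

module _ {R n μ ι T} (st : State R n μ ι T) where
  open State st

  private
    U = transpose T

  next-contraction : ∀ {i ν} → suc n ≤ R → Part ν → μ ≡ addBox i ν → Next R n ν ι T (contraction i)
  next-contraction {i} {ν} n<R pν μ≡
    with colDelete-Del i isTab
           (Unique-resp-↭ (↭-reverse (word U)) (Unique-++⁻ʳ (invWordFrom 1 R ι) (sunWord-unique st)))
           (trans shape≡ μ≡) pν
  ... | T' , x , del≡ , tab' , shape≡' , d = record
    { sun₁≡    = sun≡
    ; state    = record
      { isTab   = tab'
      ; shape≡  = shape≡'
      ; bounded = bounded'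
      ; symm    = symm'
      ; perm    = Insertion-↭ ins perm }
    ; lastStep = contracted (invApply-fst x k ι) (transpose-IsTab isTab) d
    ; inserted = ins
    ; outcome  = out }
    where
    k  = suc n
    n≤R = <⇒≤ n<R
    ι' = (x , k) ∷ ι
    U' = transpose T'
    sun≡ : ∀ ss → sun₁ (suc n) (contraction i ∷ ss) ι T ≡ sun₁ (suc (suc n)) ss ι' T'
    sun≡ ss rewrite del≡ = refl
    del~ : word U ~ word U' ++ [ x ]
    del~ = Del-word d (transpose-IsTab isTab)
    x∈U : x ∈ word U
    x∈U = ∈-resp-↭ (↭-sym (~⇒↭ del~)) (∈-++⁺ʳ (word U') (here refl))
    1≤x = proj₁ (sunWord-range st (entry∈sunWord st x∈U))
    x≤n = proj₂ (sunWord-range st (entry∈sunWord st x∈U))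
    x≢k : x ≢ k
    x≢k = <⇒≢ (s≤s x≤n)
    x∉ι : invApply x ι ≡ nothing
    x∉ι = unpaired-entry st n≤R x∈U
    ext = invWord-extend 1≤x x≤n n<R x∉ι (unpaired-later st)
    u = proj₁ ext
    v = proj₁ (proj₂ ext)
    -- The deletion splits `x` off the end of `word U`, that is, off the front of its reverse. This
    -- is next to the end of the word of `ι`, where the new pair also places `x`.
    new~ : u ++ k ∷ v ++ reverse (word U) ~ sunWord R ι' T'
    new~ = ~trans (~-++ˡ u (~prep k (~-++ˡ v
             (~trans (~-reverse del~) (~-reflexive (reverse-++ (word U') [ x ]))))))
             (~-reflexive (sym (trans (cong (_++ reverse (word U')) (proj₂ (proj₂ (proj₂ ext))))
               (trans (++-assoc u (k ∷ v ++ [ x ]) _) (cong (λ z → u ++ k ∷ z) (++-assoc v [ x ] _))))))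
    ins : Insertion k (sunWord R ι T) (sunWord R ι' T')
    ins = insertion u (v ++ reverse (word U))
      (trans (cong (_++ reverse (word U)) (proj₁ (proj₂ (proj₂ ext)))) (++-assoc u v _)) new~
    bounded' : ∀ {a b} → invApply a ι' ≡ just b → 1 ≤ a × a ≤ k
    bounded' {a} e with a ≟ x | a ≟ k
    ... | yes refl | _        = 1≤x , m≤n⇒m≤1+n x≤n
    ... | no _     | yes refl = s≤s z≤n , ≤-refl
    ... | no a≢x   | no a≢k   =
      let l , h = bounded (trans (sym (invApply-other x k ι a≢x a≢k)) e) in l , m≤n⇒m≤1+n h
    symm' : ∀ {a b} → invApply a ι' ≡ just b → invApply b ι' ≡ just a
    symm' {a} {b} e with a ≟ x | a ≟ k
    ... | yes refl | _ with trans (sym (invApply-fst x k ι)) e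
    ...   | refl = invApply-snd x k ι x≢k
    symm' {a} {b} e | no _ | yes refl with trans (sym (invApply-snd x k ι x≢k)) e
    ...   | refl = invApply-fst x k ι
    symm' {a} {b} e | no a≢x | no a≢k = trans (invApply-other x k ι b≢x b≢k) eb
      where
      eb : invApply b ι ≡ just a
      eb = symm (trans (sym (invApply-other x k ι a≢x a≢k)) e)
      -- Neither `x` nor `k` had a partner in `ι`, so the new pair shadows no older one.
      b≢x : b ≢ x
      b≢x refl with trans (sym x∉ι) eb
      ... | ()
      b≢k : b ≢ k
      b≢k refl with trans (sym (unpaired-later st k ≤-refl)) eb
      ... | ()
    out : ∀ {μ s} → Part μ → StepRel μ ν (contraction i) → LastStep n μ ι T s →
          Outcome n s (contraction i) (sunWord R ι' T')
    -- Read off the left side of `new~`, where all entries of `T` are still in place, so that `n`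
    -- may itself be the ejected letter.
    out _ _ (expanded a) = inj₁ (exp-con , Before-resp-~ (inj₁ refl) new~
      (Before-++⁺ʳ u (here (∈-++⁺ʳ v (∈-reverse⁺ (At⇒∈ (At-transpose (IsTab⇒Part isTab) a)))))))
    out pμ (contract refl) (contracted {i₀} {x₀} e t₀ d₀) with i <? i₀ | Del-Del t₀ d₀ d
    -- The deleted boxes lie in columns `rowLen i₀ (addBox i ν)` and `rowLen i ν`. A second box
    -- strictly higher is weakly further right, and otherwise it is strictly further left; so the
    -- first two combinations are impossible.
    ... | yes i<i₀ | inj₁ (j<j₀ , _) = ⊥-elim (<-irrefl refl (<-≤-trans j<j₀
      (≤-trans (≤-reflexive (rowLen-addBox-≢ i₀ i ν (≢-sym (<⇒≢ i<i₀)))) (rowLen-anti pν (<⇒≤ i<i₀)))))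
    ... | no i≮i₀  | inj₂ (j₀≤j , _) = ⊥-elim (<-irrefl refl
      (<-≤-trans (≤-reflexive (sym (rowLen-addBox i ν))) (≤-trans (rowLen-anti pμ (≮⇒≥ i≮i₀)) j₀≤j)))
    -- The word of the new involution has `n + 1` at index `x` and `n` at index `x₀`, so the order
    -- of the ejected letters is that of `n + 1` and `n`.
    ... | yes i<i₀ | inj₂ (_ , x<x₀) = inj₁ (con-con i<i₀ ,
      Before-++⁺ˡ _ (invWordFrom-Before (invApply-fst x k ι) e' 1≤x x<x₀ (s≤s (≤-trans x₀≤n n≤R))))
      where
      x₀≤n = proj₂ (bounded e)
      e' : invApply x₀ ι' ≡ just n
      e' = trans (invApply-other x k ι (≢-sym (<⇒≢ x<x₀)) (<⇒≢ (s≤s x₀≤n))) e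
    ... | no i≮i₀  | inj₁ (_ , x₀<x) = inj₂ ((λ { (con-con i<i₀) → i≮i₀ i<i₀ }) ,
      Before-++⁺ˡ _ (invWordFrom-Before e' (invApply-fst x k ι) (proj₁ (bounded e)) x₀<x (s≤s (≤-trans x≤n n≤R))))
      where
      e' : invApply x₀ ι' ≡ just n
      e' = trans (invApply-other x k ι (<⇒≢ x₀<x) (<⇒≢ (s≤s (proj₂ (bounded e))))) e

-- All steps in sequence

next : ∀ {R n μ ν ι T t} → State R n μ ι T → suc n ≤ R → Part ν → StepRel μ ν t → Next R n ν ι T t
next st n<R pν (expand refl) = next-expansion st n<R pν
next st n<R pν (contract e)  = next-contraction st n<R pν e

Outcomes : ℕ → List Step → Word → Set
Outcomes n (s ∷ t ∷ ss) w = Outcome n s t w × Outcomes (suc n) (t ∷ ss) w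
Outcomes n _            w = ⊤

Outcomes-lookup : ∀ {n s t w} ss m → Outcomes n ss w → nth m ss ≡ just s → nth (suc m) ss ≡ just t →
  Outcome (n + m) s t w
Outcomes-lookup {n} {s} {t} {w} (s ∷ t ∷ ss) zero (o , _) refl refl =
  subst (λ m → Outcome m s t w) (sym (+-identityʳ n)) o
Outcomes-lookup {n} {s} {t} {w} (_ ∷ ss@(_ ∷ _)) (suc m) (_ , os) e e' =
  subst (λ m → Outcome m s t w) (sym (+-suc n m)) (Outcomes-lookup ss m os e e')

Outcome-mono : ∀ {n s t w w'} → (∀ {p q} → Consecutive p q → Before p q w → Before p q w') →
  Outcome n s t w → Outcome n s t w'
Outcome-mono f (inj₁ (d , b))  = inj₁ (d , f (inj₁ refl) b)
Outcome-mono f (inj₂ (¬d , b)) = inj₂ (¬d , f (inj₂ refl) b)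

sun₁Word : ℕ → Involution × Tableau → Word
sun₁Word R (ι , T) = sunWord R ι T

-- Indexed by the output pair as a whole, so that it can be transported along `sun₁≡`. The word `w`
-- is an intermediate one, and all outcomes refer to the final one.
record Result (R n : ℕ) (ss : List Step) (w : Word) (res : Involution × Tableau) : Set where
  field
    {μ} : Partition
    state    : State R R μ (proj₁ res) (proj₂ res)
    before   : ∀ {p q} → Consecutive p q → Before p q w → Before p q (sun₁Word R res)
    outcomes : Outcomes n ss (sun₁Word R res)

-- The step `s` already taken stays at the head of the list, since the first pair to be judged is
-- `s` with the next step. That outcome holds in the word right after the next step, and `before` of
-- the induction hypothesis carries it to the end.
run : ∀ {R n μ s ι T} ps → Linked DiffOneBox (μ ∷ ps) → All IsPartition (μ ∷ ps) →
  State R n μ ι T → LastStep n μ ι T s → n + length (steps (μ ∷ ps)) ≡ R →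
  Result R n (s ∷ steps (μ ∷ ps)) (sunWord R ι T) (sun₁ (suc n) (steps (μ ∷ ps)) ι T)
run {n = n} [] _ _ st _ eq = record
  { state    = subst (λ m → State _ m _ _ _) (trans (sym (+-identityʳ n)) eq) st
  ; before   = λ _ b → b
  ; outcomes = tt }
run {R} {n} {μ} {s} {ι} {T} (ν ∷ ps) (δ ∷ lk) (pμ ∷ pν ∷ pps) st ls eq =
  subst (Result R n (s ∷ stepOf μ ν ∷ steps (ν ∷ ps)) (sunWord R ι T)) (sym (Next.sun₁≡ nx (steps (ν ∷ ps))))
    (record
      { state    = Result.state ih
      ; before   = λ c b → Result.before ih c (Insertion-Before (Next.inserted nx) c b)
      ; outcomes = Outcome-mono (Result.before ih) (Next.outcome nx (IsPartition⇒Part pμ) rel ls) ,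
                   Result.outcomes ih })
  where
  rel = stepOf-rel δ (IsPartition⇒Part pμ) (IsPartition⇒Part pν)
  eq' : suc n + length (steps (ν ∷ ps)) ≡ R
  eq' = trans (sym (+-suc n _)) eq
  nx = next st (subst (suc n ≤_) eq' (m≤m+n (suc n) _)) (IsPartition⇒Part pν) rel
  ih = run ps lk (pν ∷ pps) (Next.state nx) (Next.lastStep nx) eq'

invWordFrom-[] : ∀ a R → invWordFrom a R [] ≡ []
invWordFrom-[] a R = invWordFrom-empty a R [] (λ _ _ → refl)

initial : ∀ R → State R 0 [] [] []
initial R = record
  { isTab = [] ; shape≡ = refl ; bounded = λ () ; symm = λ ()
  ; perm = ↭-reflexive (trans (++-identityʳ _) (invWordFrom-[] 1 R)) }

-- The first step is taken outside `run`, which presupposes a last step.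
sun₁-result : ∀ ps → IsOscTableau ps →
  ∃ λ w → Result (length (steps ps)) 1 (steps ps) w (sun₁ 1 (steps ps) [] [])
sun₁-result _ (([] , refl) , _) =
  _ , record { state = initial 0 ; before = λ _ b → b ; outcomes = tt }
sun₁-result _ ((ν ∷ ps , refl) , _ ∷ pν ∷ pps , δ ∷ lk) =
  _ , subst (Result R 1 (stepOf [] ν ∷ steps (ν ∷ ps)) _) (sym (Next.sun₁≡ nx (steps (ν ∷ ps))))
        (run ps lk (pν ∷ pps) (Next.state nx) (Next.lastStep nx) refl)
  where
  R = suc (length (steps (ν ∷ ps)))
  nx = next (initial R) (s≤s z≤n) (IsPartition⇒Part pν) (stepOf-rel δ [] (IsPartition⇒Part pν))

-- Sun₂ and the theorem

-- Column insertion is row insertion into the transpose. Between two insertions the double transpose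
-- cancels because the shape is a partition.
sun₂-IsTab×word : ∀ ws {Q} S → IsTab Q → Unique (word (transpose Q) ++ map proj₁ ws) →
  let Q' = proj₁ (sun₂ ws Q S) in
  IsTab Q' × word (transpose Q) ++ map proj₁ ws ~ word (transpose Q')
sun₂-IsTab×word [] {Q} S t _ = t , ~-reflexive (++-identityʳ _)
sun₂-IsTab×word ((x , l) ∷ ws) {Q} S t u = proj₁ ih , ~trans step~ (proj₂ ih)
  where
  U = transpose Q
  xs = map proj₁ ws
  assoc : word U ++ x ∷ xs ≡ (word U ++ [ x ]) ++ xs
  assoc = sym (++-assoc (word U) [ x ] xs)
  ins = rowInsert-IsTab×word x (transpose-IsTab t)
          (Unique-++⁻ˡ (word U ++ [ x ]) (subst Unique assoc u))
  U'≡ : transpose (colInsert x Q) ≡ rowInsert x U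
  U'≡ = transpose-involutive (rowInsert x U) (IsTab⇒Part (proj₁ ins))
  step~ : word U ++ x ∷ xs ~ word (transpose (colInsert x Q)) ++ xs
  step~ = ~trans (~-reflexive assoc)
    (~-++ʳ xs (~trans (proj₂ ins) (~-reflexive (cong word (sym U'≡)))))
  ih = sun₂-IsTab×word ws (((newBox (shape Q) (shape (colInsert x Q))) , l) ∷ S)
         (transpose-IsTab (proj₁ ins)) (Unique-resp-↭ (~⇒↭ step~) u)

word-labelRows : ∀ i I → map proj₁ (concat (reverse (labelRows i I))) ≡ word I
word-labelRows i []       = refl
word-labelRows i (r ∷ rs) = begin
  map proj₁ (concat (reverse (L ∷ labelRows (suc i) rs)))
    ≡⟨ cong (λ z → map proj₁ (concat z)) (unfold-reverse L (labelRows (suc i) rs)) ⟩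
  map proj₁ (concat (reverse (labelRows (suc i) rs) ++ [ L ]))
    ≡⟨ cong (map proj₁) (sym (concat-++ (reverse (labelRows (suc i) rs)) [ L ])) ⟩
  map proj₁ (concat (reverse (labelRows (suc i) rs)) ++ L ++ [])
    ≡⟨ map-++ proj₁ (concat (reverse (labelRows (suc i) rs))) (L ++ []) ⟩
  map proj₁ (concat (reverse (labelRows (suc i) rs))) ++ map proj₁ (L ++ [])
    ≡⟨ cong₂ _++_ (word-labelRows (suc i) rs) (cong (map proj₁) (++-identityʳ L)) ⟩
  word rs ++ map proj₁ L
    ≡⟨ cong (word rs ++_) (trans (sym (map-∘ r)) (map-id r)) ⟩
  word rs ++ r ∎
  where
  open ≡-Reasoning
  L = map (λ x → x , i) r

word-revReadingLabelled : ∀ I → map proj₁ (revReadingLabelled I) ≡ reverse (word I)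
word-revReadingLabelled I =
  trans (reverse-map proj₁ (concat (reverse (labelRows 1 I)))) (cong reverse (word-labelRows 1 I))

rowInserts-word : ∀ w {T} → IsTab T → Unique (word T ++ w) →
  word T ++ w ~ word (foldl (λ T x → rowInsert x T) T w)
rowInserts-word []      _ _ = ~-reflexive (++-identityʳ _)
rowInserts-word (x ∷ w) {T} t u = ~trans step~ (rowInserts-word w (proj₁ ins) (Unique-resp-↭ (~⇒↭ step~) u))
  where
  assoc = sym (++-assoc (word T) [ x ] w)
  ins = rowInsert-IsTab×word x t (Unique-++⁻ˡ (word T ++ [ x ]) (subst Unique assoc u))
  step~ : word T ++ x ∷ w ~ word (rowInsert x T) ++ w
  step~ = ~trans (~-reflexive assoc) (~-++ʳ w (proj₂ ins))

-- Inserting the reversed reading word of `I` appends it to `word (transpose T)`. Reversing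
-- everything puts `word I` in front, and this is equivalent to the word of `ι` from which `I` was
-- built.
sun₂-word : ∀ {R μ ι T} → State R R μ ι T →
  let Q = proj₁ (sun₂ (revReadingLabelled (insertionTableau (invWordFrom 1 R ι))) T []) in
  IsTab Q × reverse (word (transpose Q)) ~ sunWord R ι T
sun₂-word {R} {μ} {ι} {T} st = proj₁ q , ~trans (~-reverse (~sym (proj₂ q))) rev~
  where
  w = invWordFrom 1 R ι
  U = transpose T
  I = insertionTableau w
  ws = revReadingLabelled I
  I~ : w ~ word I
  I~ = rowInserts-word w [] (Unique-++⁻ˡ w (sunWord-unique st))
  rev~ : reverse (word U ++ map proj₁ ws) ~ sunWord R ι T
  rev~ = ~trans (~-reflexive (trans (reverse-++ (word U) (map proj₁ ws))
           (cong (_++ reverse (word U))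
             (trans (cong reverse (word-revReadingLabelled I)) (reverse-involutive (word I))))))
           (~-++ʳ (reverse (word U)) (~sym I~))
  q = sun₂-IsTab×word ws [] (State.isTab st)
        (Unique-resp-↭ (↭-trans (~⇒↭ (~sym rev~)) (↭-reverse _)) (sunWord-unique st))

nth-exists : ∀ {A : Set} m (xs : List A) → m < length xs → ∃ λ x → nth m xs ≡ just x
nth-exists zero    (x ∷ xs) _       = x , refl
nth-exists (suc m) (x ∷ xs) (s≤s l) = nth-exists m xs l

theorem6p1 : (ps : List Partition) → IsOscTableau ps →
    ∀ (k : ℕ) → IsOscDescent ps k ⇔ IsTabDescent (proj₁ (Sun ps)) k
theorem6p1 ps osc k with sun₁ 1 (steps ps) [] [] | sun₁-result ps osc
... | ι , T | _ , res = mk⇔ to from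
  where
  R = length (steps ps)
  st = Result.state res
  W = sunWord R ι T
  Q = proj₁ (sun₂ (revReadingLabelled (insertionTableau (invWordFrom 1 R ι))) T [])
  tQ = proj₁ (sun₂-word st)
  pQ = IsTab⇒Part tQ
  Q~W : reverse (word (transpose Q)) ~ W
  Q~W = proj₂ (sun₂-word st)
  uW = sunWord-unique st

  ∈Q⇒∈W : ∀ {x} → x ∈ word Q → x ∈ W
  ∈Q⇒∈W x∈ = ∈-resp-↭ (~⇒↭ Q~W) (∈-reverse⁺ (∈-transpose pQ x∈))

  ∈W⇒∈Q : ∀ {x} → x ∈ W → x ∈ word Q
  -- `∈-transpose` goes from a tableau to its transpose only, so it is applied to `transpose Q` and
  -- the double transpose is removed.
  ∈W⇒∈Q {x} x∈ = subst (λ V → x ∈ word V) (transpose-involutive Q pQ)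
    (∈-transpose (transpose-Part Q pQ)
      (∈-resp-↭ (↭-trans (~⇒↭ (~sym Q~W)) (↭-reverse _)) x∈))

  Q⇒W : ∀ {p q} → Consecutive p q → Before q p (word (transpose Q)) → Before p q W
  Q⇒W c b = Before-resp-~ c Q~W (Before-reverse b)

  to : IsOscDescent ps k → IsTabDescent Q k
  to (s≤s {n = m} z≤n , s , t , es , et , d) with Outcomes-lookup (steps ps) m (Result.outcomes res) es et
  ... | inj₂ (¬d , _) = ⊥-elim (¬d d)
  ... | inj₁ (_ , b) with ∈⇒rowOf Q (∈W⇒∈Q (Before⇒∈ʳ b)) | ∈⇒rowOf Q (∈W⇒∈Q (Before⇒∈ˡ b))
  ...   | i , ei | j , ej with i <? j
  ...     | yes i<j = i , j , ei , ej , i<j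
  -- With `k + 1` weakly above `k`, the letter `k` would precede `k + 1` in `W`, against the outcome
  -- of a descent.
  ...     | no i≮j  = ⊥-elim (Before-asym uW b (Q⇒W (inj₂ refl)
              (ascent⇒Before tQ (proj₂ (rowOf⇒At Q ei)) (proj₂ (rowOf⇒At Q ej)) (≮⇒≥ i≮j))))

  from : IsTabDescent Q k → IsOscDescent ps k
  from (i , j , ei , ej , i<j) =
    descent k refl (proj₁ (sunWord-range st (∈Q⇒∈W (At⇒∈ a)))) (proj₂ (sunWord-range st (∈Q⇒∈W (At⇒∈ a'))))
    where
    a  = proj₂ (rowOf⇒At Q ei)
    a' = proj₂ (rowOf⇒At Q ej)
    -- Entries of `Q` are letters of `W`, hence between 1 and `R`, so that steps `k` and `k + 1`
    -- both exist. Step `suc m` has list index `m`.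
    descent : ∀ k' → k' ≡ k → 1 ≤ k' → suc k' ≤ R → IsOscDescent ps k'
    descent (suc m) refl _ k<R
      with nth-exists m (steps ps) (<-trans ≤-refl k<R) | nth-exists (suc m) (steps ps) k<R
    ... | s , es | t , et with Outcomes-lookup (steps ps) m (Result.outcomes res) es et
    ...   | inj₁ (d , _) = s≤s z≤n , s , t , es , et , d
    ...   | inj₂ (_ , b) = ⊥-elim (Before-asym uW b (Q⇒W (inj₁ refl) (descent⇒Before tQ a a' i<j)))
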